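{- Let $q$ be a prime power and let $\mathcal{F}_q$ be the smallest class of simple matroids representable over $\mathbb{F}_q$ such that: (i) every supersolvable simple matroid representable over $\mathbb{F}_q$ belongs to $\mathcal{F}_q$; (ii) $\mathcal{F}_q$ is closed under taking modular joins over projective geometries, i.e. if a simple $\mathbb{F}_q$-representable matroid $M$ is a modular join $P_X(M_1,M_2)$ with $M_1,M_2\in\mathcal{F}_q$ and $M|X\simeq\mathrm{PG}(n,q)$ for some $n$, then $M\in\mathcal{F}_q$. If $\mathcal{A}$ is a central hyperplane arrangement over $\mathbb{F}_q$ whose linear dependence matroid belongs to $\mathcal{F}_q$, then $\mathcal{A}$ is divisionally free.
   Context: All matroids are finite. For a simple matroid $M$ on ground set $E$ with rank function $r$, flats ordered by inclusion form the lattice $L(M)$, with $X\vee Y=\mathrm{cl}(X\cup Y)$. A flat $X$ is modular if $r(X)+r(Y)=r(X\cap Y)+r(X\vee Y)$ for all flats $Y$. $M$ is supersolvable if it has a maximal chain of flats consisting of modular flats. $M=P_X(M_1,M_2)$ (a modular join over $X$) means there are proper modular flats $E_1,E_2$ with $E=E_1\cup E_2$, $X=E_1\cap E_2$, $M_i=M|E_i$. $\mathrm{PG}(n,q)$ is the simple matroid of all one-dimensional subspaces of $\mathbb{F}_q^{n+1}$ under linear dependence. $\chi(M,t)=\sum_{X\in L(M)}\mu(X)t^{r(E)-r(X)}$ ($\mu$ the Möbius function from the bottom), computed for contractions from their lattice of flats. A divisional flag of $M$ of rank $n$ is a chain of flats $\varnothing=X_0\subseteq\dots\subseteq X_n=E$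 with $r(X_i)=i$ and $\chi(M/X_{i+1},t)\mid\chi(M/X_i,t)$. The linear dependence matroid $M(\mathcal{A})$ of a central arrangement $\mathcal{A}$ is the matroid on $\mathcal{A}$ where $\{H_1,\dots,H_k\}$ is independent iff $\operatorname{codim}(H_1\cap\dots\cap H_k)=k$; $\mathcal{A}$ is divisionally free if $M(\mathcal{A})$ has a divisional flag. -}

module Defs where

open import Level using (0ℓ)
open import Data.Bool using (Bool; true; false; _∧_; not; if_then_else_)
import Data.Bool as B
open import Data.Nat as ℕ using (ℕ; zero; suc; _≤_; _∸_)
import Data.Nat.Properties as ℕP
open import Data.Integer as ℤ using (ℤ)
open import Data.Fin using (Fin; zero; suc; toℕ; inject₁; fromℕ)
open import Data.Fin.Subset using (Subset; _∈_; _∉_; _⊆_; _∪_; _∩_; ⁅_⁆; ∣_∣; ⊥; ⊤)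
open import Data.Fin.Subset.Properties using (_⊆?_)
open import Data.Vec as V using (Vec; []; _∷_; tabulate; lookup)
open import Data.Vec.Properties using (≡-dec)
open import Data.List as L using (List; []; _∷_; map; _++_; upTo)
open import Data.Product using (Σ; ∃; _×_; _,_)
open import Relation.Nullary using (¬_; ⌊_⌋)
open import Relation.Binary.PropositionalEquality using (_≡_; _≢_)
open import Algebra.Structures using (IsCommutativeRing)
open import Function.Bundles using (Inverse)
open import Function.Base using (_∘_)

record FiniteField (q : ℕ) : Set₁ where
  field
    K    : Set
    _+_  : K → K → K
    _*_  : K → K → K
    -_   : K → K
    0#   : K
    1#   : K
    isCommutativeRing : IsCommutativeRing _≡_ _+_ _*_ -_ 0# 1#
    0≢1  : 0# ≢ 1#
    inv  : ∀ x → x ≢ 0# → ∃ λ y → x * y ≡ 1#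
    enum : Inverse (Relation.Binary.PropositionalEquality.setoid (Fin q))
                   (Relation.Binary.PropositionalEquality.setoid K)

module LinAlg {q : ℕ} (F : FiniteField q) where
  open FiniteField F

  sumF : ∀ {n} → (Fin n → K) → K
  sumF {zero}  f = 0#
  sumF {suc n} f = f zero + sumF (f ∘ suc)

  -- the family (v i)_{i ∈ S} of vectors in K^d is linearly independent
  -- (as a family, i.e. repeated vectors are dependent)
  LinIndep : ∀ {n d} → (Fin n → Fin d → K) → Subset n → Set
  LinIndep {n} {d} v S =
    (c : Fin n → K) → (∀ i → i ∉ S → c i ≡ 0#) →
    (∀ j → sumF (λ i → c i * v i j) ≡ 0#) → ∀ i → c i ≡ 0#

  dot : ∀ {d} → (Fin d → K) → (Fin d → K) → K
  dot a x = sumF (λ j → a j * x j)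

  NonZeroVec : ∀ {d} → (Fin d → K) → Set
  NonZeroVec w = ¬ (∀ j → w j ≡ 0#)

  IsDim : ∀ {ℓ} → ((Fin ℓ → K) → Set) → ℕ → Set
  IsDim {ℓ} W k =
    (∃ λ (w : Fin k → Fin ℓ → K) → (∀ a → W (w a)) × LinIndep w ⊤) ×
    ¬ (∃ λ (w : Fin (suc k) → Fin ℓ → K) → (∀ a → W (w a)) × LinIndep w ⊤)

  HasCodim : ∀ {ℓ} → ((Fin ℓ → K) → Set) → ℕ → Set
  HasCodim {ℓ} W c = ∃ λ d → IsDim W d × d ℕ.+ c ≡ ℓ

  -- central arrangement of n distinct hyperplanes H_i = ker (α i) in K^ℓ
  record Arrangement (ℓ n : ℕ) : Set where
    field
      α        : Fin n → Fin ℓ → K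
      nonzero  : ∀ i → NonZeroVec (α i)
      distinct : ∀ i i' → i ≢ i' →
                 ¬ (∀ (x : Fin ℓ → K) →
                      (dot (α i) x ≡ 0# → dot (α i') x ≡ 0#) ×
                      (dot (α i') x ≡ 0# → dot (α i) x ≡ 0#))

    Inter : Subset n → (Fin ℓ → K) → Set
    Inter S x = ∀ i → i ∈ S → dot (α i) x ≡ 0#

-- Matroids on Fin n via rank functions.  Notions below are relative to
-- a ground set E ⊆ Fin n, i.e. they concern the restriction M|E.

record Matroid (n : ℕ) : Set where
  field
    r        : Subset n → ℕ
    r-card   : ∀ X → r X ≤ ∣ X ∣
    r-mono   : ∀ X Y → X ⊆ Y → r X ≤ r Y
    r-submod : ∀ X Y → r (X ∪ Y) ℕ.+ r (X ∩ Y) ≤ r X ℕ.+ r Y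

_≟S_ : ∀ {n} → (X Y : Subset n) → Relation.Nullary.Dec (X ≡ Y)
_≟S_ = ≡-dec B._≟_

allSubsets : ∀ n → List (Subset n)
allSubsets zero    = [] ∷ []
allSubsets (suc n) = map (true ∷_) (allSubsets n) ++ map (false ∷_) (allSubsets n)

sumℤ : List ℤ → ℤ
sumℤ = L.foldr ℤ._+_ (ℤ.+ 0)

module _ {n : ℕ} (M : Matroid n) (E : Subset n) where
  open Matroid M

  cl : Subset n → Subset n
  cl X = tabulate (λ e → lookup E e ∧ ⌊ r (X ∪ ⁅ e ⁆) ℕ.≟ r X ⌋)

  Flat : Subset n → Set
  Flat X = cl X ≡ X

  isFlat : Subset n → Bool
  isFlat X = ⌊ cl X ≟S X ⌋

  _∨_ : Subset n → Subset n → Subset n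
  X ∨ Y = cl (X ∪ Y)

  Modular : Subset n → Set
  Modular X = Flat X × (∀ Y → Flat Y → r X ℕ.+ r Y ≡ r (X ∩ Y) ℕ.+ r (X ∨ Y))

  Simple : Set
  Simple = (∀ e → e ∈ E → r ⁅ e ⁆ ≡ 1) ×
           (∀ e f → e ∈ E → f ∈ E → e ≢ f → r (⁅ e ⁆ ∪ ⁅ f ⁆) ≡ 2)

  Supersolvable : Set
  Supersolvable = ∃ λ (C : Fin (suc (r E)) → Subset n) →
    (∀ i → Modular (C i) × r (C i) ≡ toℕ i) ×
    (∀ (i : Fin (r E)) → C (inject₁ i) ⊆ C (suc i)) ×
    C zero ≡ cl ⊥ × C (fromℕ (r E)) ≡ E

  -- Möbius function μ(X,Y) on the lattice of flats of M|E (fuel = |Y|+1)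
  μ' : ℕ → Subset n → Subset n → ℤ
  μ' zero    X Y = ℤ.+ 0
  μ' (suc k) X Y =
    if ⌊ Y ≟S X ⌋ then ℤ.+ 1 else
      ℤ.- sumℤ (map (λ Z → if isFlat Z ∧ ⌊ X ⊆? Z ⌋ ∧ ⌊ Z ⊆? Y ⌋ ∧ not ⌊ Z ≟S Y ⌋
                           then μ' k X Z else ℤ.+ 0)
                    (allSubsets n))

  μ : Subset n → Subset n → ℤ
  μ X Y = μ' (suc ∣ Y ∣) X Y

  -- coefficient of t^k in χ(M/X, t) = Σ_{Y flat ⊇ X} μ(X,Y) t^{r(E) - r(Y)}
  χ : Subset n → ℕ → ℤ
  χ X k = sumℤ (map (λ Y → if isFlat Y ∧ ⌊ X ⊆? Y ⌋ ∧ ⌊ r E ∸ r Y ℕ.≟ k ⌋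
                           then μ X Y else ℤ.+ 0)
                    (allSubsets n))

-- polynomials in ℤ[t] given by coefficient functions / coefficient lists
coeffL : List ℤ → ℕ → ℤ
coeffL []       _       = ℤ.+ 0
coeffL (a ∷ as) zero    = a
coeffL (a ∷ as) (suc k) = coeffL as k

PolyDivides : (ℕ → ℤ) → (ℕ → ℤ) → Set
PolyDivides f g = ∃ λ (h : List ℤ) →
  ∀ k → g k ≡ sumℤ (map (λ i → f i ℤ.* coeffL h (k ∸ i)) (upTo (suc k)))

module _ {n : ℕ} (M : Matroid n) (E : Subset n) where
  open Matroid M

  HasDivisionalFlag : Set
  HasDivisionalFlag = ∃ λ (X : Fin (suc (r E)) → Subset n) →
    X zero ≡ ⊥ × X (fromℕ (r E)) ≡ E ×
    (∀ i → Flat M E (X i) × r (X i) ≡ toℕ i) ×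
    (∀ (i : Fin (r E)) → X (inject₁ i) ⊆ X (suc i) ×
        PolyDivides (χ M E (X (suc i))) (χ M E (X (inject₁ i))))

module MatroidsOver {q : ℕ} (F : FiniteField q) where
  open FiniteField F
  open LinAlg F

  module _ {n : ℕ} (M : Matroid n) where
    open Matroid M

    Representable : Subset n → Set
    Representable E = ∃ λ d → ∃ λ (v : Fin n → Fin d → K) →
      ∀ S → S ⊆ E → ((r S ≡ ∣ S ∣ → LinIndep v S) × (LinIndep v S → r S ≡ ∣ S ∣))

    -- M|X ≅ PG(m,q): x ↦ ⟨v x⟩ is a bijection from X onto the 1-dim subspaces
    -- of K^{m+1} preserving independence
    IsoPG : Subset n → ℕ → Set
    IsoPG X m = ∃ λ (v : Fin n → Fin (suc m) → K) →
      (∀ x → x ∈ X → NonZeroVec (v x)) ×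
      (∀ S → S ⊆ X → ((r S ≡ ∣ S ∣ → LinIndep v S) × (LinIndep v S → r S ≡ ∣ S ∣))) ×
      (∀ (w : Fin (suc m) → K) → NonZeroVec w →
         ∃ λ x → x ∈ X × ∃ λ c → ∀ j → w j ≡ c * v x j) ×
      (∀ x y → x ∈ X → y ∈ X → (∃ λ c → ∀ j → v y j ≡ c * v x j) → x ≡ y)

    data InF : Subset n → Set where
      supersolvable : ∀ {E} → Simple M E → Representable E →
                      Supersolvable M E → InF E
      modularJoin   : ∀ {E} → Simple M E → Representable E →
                      (E₁ E₂ : Subset n) →
                      Modular M E E₁ → ¬ (E ⊆ E₁) →
                      Modular M E E₂ → ¬ (E ⊆ E₂) →
                      E ≡ E₁ ∪ E₂ →
                      InF E₁ → InF E₂ →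
                      (m : ℕ) → IsoPG (E₁ ∩ E₂) m →
                      InF E

  module _ {ℓ n : ℕ} (A : Arrangement ℓ n) (M : Matroid n) where
    open Matroid M
    open Arrangement A

    IsMatroidOf : Set
    IsMatroidOf = ∀ S → (r S ≡ ∣ S ∣ → HasCodim (Inter S) ∣ S ∣) ×
                        (HasCodim (Inter S) ∣ S ∣ → r S ≡ ∣ S ∣)

{-# OPTIONS --safe #-}
module Submission where

-- For a flat X of E and a flat Y disjoint from X let w(E,X,Y) be the sum of μ(Y,Z) t^(r Z) over the flats Z of E
-- above Y that are disjoint from X.  Stanley's modular factorisation makes w(E,⊥,Y) the product of w(E,X,Y) and
-- χ(M|X) (up to reversal) when X is modular.  By induction on membership in the class, every round modular flat X
-- of E admits a flag from ⊥ to a complement of X along which w(E,X,·) loses one linear factor at a time; X = ⊥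
-- gives the theorem.  Projective geometries are round (not a union of two proper flats), so in a modular join E = E₁ ∪ E₂ the flat X lies in E₁, say.
-- Then a flag for E₁ ∩ E₂ in E₂ followed by one for X in E₁ works, because the flats of E disjoint from E₁ are the
-- flats of E₂ disjoint from E₁ ∩ E₂.  In the supersolvable case, with modular coatom H, the flag starts with an
-- element outside H and X if there is one; otherwise flats disjoint from X lie in H and E can be replaced by H.

-- The obstacle is gluing. In a modular join, `χ` of `E` is the product of those of `E₁` and `E₂`
-- divided by that of `E₁ ∩ E₂`, and an arbitrary divisional flag of `E₂` says nothing about this
-- quotient. The induction therefore has to supply flags for quotients, and its statement has to
-- survive the next join, which is why `X` must fit into one of the two sides. Two moves connect
-- different choices of `X`. A linear factor that splits off relative to a modular flat `F` also
-- splits off relative to any subset of `F`, because the polynomials at both ends of the step are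
-- multiplied by the same factor. A linear factor that splits off relative to `⊥` also splits off
-- relative to a modular `X` avoided by both flats of the step, because the reversed polynomial of
-- `X` has constant term 1 and can be cancelled.

open import Defs
open import Data.Bool.Base using (true; false; if_then_else_)
import Data.Bool.Base as Bool
import Data.Bool.Properties as Boolₚ
open import Data.Empty as Empty using (⊥-elim)
open import Data.Fin.Base using (Fin; zero; suc; toℕ; inject₁; fromℕ)
open import Data.Fin.Induction using (<-weakInduction)
import Data.Fin.Properties as Finₚ
open import Data.Fin.Subset using (Subset; _∈_; _∉_; _⊆_; _∪_; _∩_; ∣_∣; ⁅_⁆; ⊥; ⊤; Nonempty)
open import Data.Fin.Subset.Properties
open import Data.Integer.Base as ℤ using (ℤ; 0ℤ; 1ℤ)
import Data.Integer.Properties as ℤₚ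
open import Data.Integer.Tactic.RingSolver using (solve-∀)
import Data.List.Base as List
import Data.List.Properties as Listₚ
open import Data.Nat.Base as ℕ using (ℕ; zero; suc; _∸_; _≤_; _<_; z≤n; s≤s; s≤s⁻¹)
import Data.Nat.Properties as ℕₚ
open import Data.Nat.Solver using (module +-*-Solver)
open import Data.Product.Base using (_×_; _,_; proj₁; proj₂; ∃)
open import Data.Sum.Base using (_⊎_; inj₁; inj₂; [_,_])
open import Data.Vec.Base using ([]; _∷_; lookup)
open import Data.Vec.Properties using (lookup⇒[]=; []=⇒lookup; lookup∘tabulate)
open import Algebra.Bundles using (CommutativeRing)
import Algebra.Properties.AbelianGroup
import Algebra.Properties.Ring
open import Function.Base using (_∘_)
open import Relation.Nullary using (¬_; Dec; yes; no; does)
open import Relation.Nullary.Decidable using (⌊_⌋; map′; _×-dec_; ¬?)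
open import Relation.Binary.PropositionalEquality
  using (_≡_; _≢_; refl; sym; trans; cong; cong₂; subst; module ≡-Reasoning)

-- Guarded integer sums over all subsets

module Sums where

  open import Data.Integer.Base using (_+_; _*_; -_; _-_)

  private
    variable
      P Q : Set

  infixr 8 _⊙_

  _⊙_ : Dec P → ℤ → ℤ
  d ⊙ x = if does d then x else 0ℤ

  ⊙-yes : (d : Dec P) → P → ∀ x → d ⊙ x ≡ x
  ⊙-yes (yes _) _ x = refl
  ⊙-yes (no ¬p) p x = ⊥-elim (¬p p)

  ⊙-no : (d : Dec P) → ¬ P → ∀ x → d ⊙ x ≡ 0ℤ
  ⊙-no (yes p) ¬p x = ⊥-elim (¬p p)
  ⊙-no (no _) _ x = refl

  ⊙-zero : (d : Dec P) → d ⊙ 0ℤ ≡ 0ℤ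
  ⊙-zero (yes _) = refl
  ⊙-zero (no _) = refl

  ⊙-*ʳ : (d : Dec P) → ∀ x y → d ⊙ (x * y) ≡ (d ⊙ x) * y
  ⊙-*ʳ (yes _) x y = refl
  ⊙-*ʳ (no _) x y = refl

  ⊙-*ˡ : (d : Dec P) → ∀ x y → d ⊙ (x * y) ≡ x * (d ⊙ y)
  ⊙-*ˡ (yes _) x y = refl
  ⊙-*ˡ (no _) x y = sym (ℤₚ.*-zeroʳ x)

  -- The workhorse for comparing sums: guards need only be logically equivalent, and the values need
  -- to agree only where the guard holds.
  ⊙-cong : (d : Dec P) (e : Dec Q) → (P → Q) → (Q → P) →
           ∀ {x y} → (P → x ≡ y) → d ⊙ x ≡ e ⊙ y
  ⊙-cong (yes p) e f g eq = trans (eq p) (sym (⊙-yes e (f p) _))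
  ⊙-cong (no ¬p) e f g eq = sym (⊙-no e (¬p ∘ g) _)

  ⊙-congʳ : (d : Dec P) → ∀ {x y} → (P → x ≡ y) → d ⊙ x ≡ d ⊙ y
  ⊙-congʳ d = ⊙-cong d d (λ p → p) (λ p → p)

  ⊙-× : (d : Dec P) (e : Dec Q) → ∀ x → d ⊙ (e ⊙ x) ≡ (d ×-dec e) ⊙ x
  ⊙-× (yes _) e x = refl
  ⊙-× (no _) e x = refl

  ⊙-* : (d : Dec P) (e : Dec Q) → ∀ x y → (d ⊙ x) * (e ⊙ y) ≡ (d ×-dec e) ⊙ (x * y)
  ⊙-* (yes _) (yes _) x y = refl
  ⊙-* (yes _) (no _) x y = ℤₚ.*-zeroʳ x
  ⊙-* (no _) e x y = refl

  ⊙-split : (d : Dec P) (e : Dec Q) → ∀ x →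
            d ⊙ x ≡ (d ×-dec e) ⊙ x + (d ×-dec ¬? e) ⊙ x
  ⊙-split (yes _) (yes _) x = sym (ℤₚ.+-identityʳ x)
  ⊙-split (yes _) (no _) x = sym (ℤₚ.+-identityˡ x)
  ⊙-split (no _) e x = refl

  sumℤ-++ : ∀ xs ys → sumℤ (xs List.++ ys) ≡ sumℤ xs + sumℤ ys
  sumℤ-++ List.[] ys = sym (ℤₚ.+-identityˡ _)
  sumℤ-++ (x List.∷ xs) ys = trans (cong (x +_) (sumℤ-++ xs ys)) (sym (ℤₚ.+-assoc x _ _))

  -- Opaque, so that the summand of ∑ f can be recovered by unification.
  abstract

    ∑ : ∀ {n} → (Subset n → ℤ) → ℤ
    ∑ {zero}  f = f []
    ∑ {suc n} f = ∑ (f ∘ (true ∷_)) + ∑ (f ∘ (false ∷_))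

    sumℤ-allSubsets : ∀ {n} (f : Subset n → ℤ) → sumℤ (List.map f (allSubsets n)) ≡ ∑ f
    sumℤ-allSubsets {zero} f = ℤₚ.+-identityʳ (f [])
    sumℤ-allSubsets {suc n} f = begin
      sumℤ (List.map f (List.map (true ∷_) (allSubsets n) List.++ List.map (false ∷_) (allSubsets n)))
        ≡⟨ cong sumℤ (Listₚ.map-++ f (List.map (true ∷_) (allSubsets n)) _) ⟩
      sumℤ (List.map f (List.map (true ∷_) (allSubsets n)) List.++
            List.map f (List.map (false ∷_) (allSubsets n)))
        ≡⟨ sumℤ-++ (List.map f (List.map (true ∷_) (allSubsets n))) _ ⟩
      sumℤ (List.map f (List.map (true ∷_) (allSubsets n))) +
      sumℤ (List.map f (List.map (false ∷_) (allSubsets n)))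
        ≡⟨ cong₂ _+_ (half true) (half false) ⟩
      ∑ f ∎
      where
      open ≡-Reasoning
      half : ∀ b → sumℤ (List.map f (List.map (b ∷_) (allSubsets n))) ≡ ∑ (f ∘ (b ∷_))
      half b = trans (cong sumℤ (sym (Listₚ.map-∘ (allSubsets n)))) (sumℤ-allSubsets (f ∘ (b ∷_)))

    ∑-cong : ∀ {n} {f g : Subset n → ℤ} → (∀ X → f X ≡ g X) → ∑ f ≡ ∑ g
    ∑-cong {zero} eq = eq []
    ∑-cong {suc n} eq = cong₂ _+_ (∑-cong (eq ∘ (true ∷_))) (∑-cong (eq ∘ (false ∷_)))

    ∑-zero : ∀ {n} {f : Subset n → ℤ} → (∀ X → f X ≡ 0ℤ) → ∑ f ≡ 0ℤ
    ∑-zero {zero} eq = eq []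
    ∑-zero {suc n} eq = cong₂ _+_ (∑-zero (eq ∘ (true ∷_))) (∑-zero (eq ∘ (false ∷_)))

    ∑-+ : ∀ {n} (f g : Subset n → ℤ) → ∑ (λ X → f X + g X) ≡ ∑ f + ∑ g
    ∑-+ {zero} f g = refl
    ∑-+ {suc n} f g = trans (cong₂ _+_ (∑-+ (f ∘ (true ∷_)) (g ∘ (true ∷_))) (∑-+ (f ∘ (false ∷_)) (g ∘ (false ∷_))))
            (interchange (∑ (f ∘ (true ∷_))) (∑ (g ∘ (true ∷_))) _ _)
      where
      interchange : ∀ a b c d → (a + b) + (c + d) ≡ (a + c) + (b + d)
      interchange = solve-∀

    ∑-*ˡ : ∀ {n} c (f : Subset n → ℤ) → ∑ (λ X → c * f X) ≡ c * ∑ f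
    ∑-*ˡ {zero} c f = refl
    ∑-*ˡ {suc n} c f = trans (cong₂ _+_ (∑-*ˡ c (f ∘ (true ∷_))) (∑-*ˡ c (f ∘ (false ∷_))))
            (sym (ℤₚ.*-distribˡ-+ c (∑ (f ∘ (true ∷_))) _))

    ∑-*ʳ : ∀ {n} c (f : Subset n → ℤ) → ∑ (λ X → f X * c) ≡ ∑ f * c
    ∑-*ʳ c f = trans (∑-cong (λ X → ℤₚ.*-comm (f X) c)) (trans (∑-*ˡ c f) (ℤₚ.*-comm c _))

    ∑-- : ∀ {n} (f g : Subset n → ℤ) → ∑ (λ X → f X - g X) ≡ ∑ f - ∑ g
    ∑-- {zero} f g = refl
    ∑-- {suc n} f g = trans (cong₂ _+_ (∑-- (f ∘ (true ∷_)) (g ∘ (true ∷_))) (∑-- (f ∘ (false ∷_)) (g ∘ (false ∷_))))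
            (interchange (∑ (f ∘ (true ∷_))) (∑ (g ∘ (true ∷_))) _ _)
      where
      interchange : ∀ a b c d → (a - b) + (c - d) ≡ (a + c) - (b + d)
      interchange = solve-∀

    ∑-⊙ : ∀ {n} (d : Dec P) (f : Subset n → ℤ) → ∑ (λ X → d ⊙ f X) ≡ d ⊙ ∑ f
    ∑-⊙ (yes _) f = refl
    ∑-⊙ {n = n} (no _) f = ∑-zero {n} (λ _ → refl)

    ∑-swap : ∀ {m n} (f : Subset m → Subset n → ℤ) →
             ∑ (λ X → ∑ (f X)) ≡ ∑ (λ Y → ∑ (λ X → f X Y))
    ∑-swap {zero} f = refl
    ∑-swap {suc m} f = trans (cong₂ _+_ (∑-swap (f ∘ (true ∷_))) (∑-swap (f ∘ (false ∷_))))
            (sym (∑-+ (λ Y → ∑ (λ X → f (true ∷ X) Y)) (λ Y → ∑ (λ X → f (false ∷ X) Y))))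

    ∑-single : ∀ {n} (Y : Subset n) (f : Subset n → ℤ) → ∑ (λ Z → (Z ≟S Y) ⊙ f Z) ≡ f Y
    ∑-single [] f = refl
    ∑-single (b ∷ Y) f = trans (cong₂ _+_ (half true b) (half false b)) (pick b)
      where
      half : ∀ c b → ∑ (λ Z → ((c ∷ Z) ≟S (b ∷ Y)) ⊙ f (c ∷ Z)) ≡ (c Boolₚ.≟ b) ⊙ f (c ∷ Y)
      half c b = begin
        ∑ (λ Z → ((c ∷ Z) ≟S (b ∷ Y)) ⊙ f (c ∷ Z))
          ≡⟨ ∑-cong (λ Z → trans (⊙-cong ((c ∷ Z) ≟S (b ∷ Y)) ((c Boolₚ.≟ b) ×-dec (Z ≟S Y))
                     (λ { refl → refl , refl }) (λ { (refl , refl) → refl }) (λ _ → refl))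
                     (sym (⊙-× (c Boolₚ.≟ b) (Z ≟S Y) _))) ⟩
        ∑ (λ Z → (c Boolₚ.≟ b) ⊙ (Z ≟S Y) ⊙ f (c ∷ Z))
          ≡⟨ ∑-⊙ (c Boolₚ.≟ b) (λ Z → (Z ≟S Y) ⊙ f (c ∷ Z)) ⟩
        (c Boolₚ.≟ b) ⊙ ∑ (λ Z → (Z ≟S Y) ⊙ f (c ∷ Z))
          ≡⟨ ⊙-congʳ (c Boolₚ.≟ b) (λ _ → ∑-single Y (f ∘ (c ∷_))) ⟩
        (c Boolₚ.≟ b) ⊙ f (c ∷ Y) ∎
        where open ≡-Reasoning
      pick : ∀ b → (true Boolₚ.≟ b) ⊙ f (true ∷ Y) + (false Boolₚ.≟ b) ⊙ f (false ∷ Y) ≡ f (b ∷ Y)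
      pick true = ℤₚ.+-identityʳ _
      pick false = ℤₚ.+-identityˡ _

  if-∧ : ∀ (d : Dec P) b x → (if ⌊ d ⌋ Bool.∧ b then x else 0ℤ) ≡ d ⊙ (if b then x else 0ℤ)
  if-∧ (yes _) b x = refl
  if-∧ (no _) b x = refl

  if-⌊⌋ : ∀ (d : Dec P) x → (if ⌊ d ⌋ then x else 0ℤ) ≡ d ⊙ x
  if-⌊⌋ (yes _) x = refl
  if-⌊⌋ (no _) x = refl

  if-not : ∀ (d : Dec P) x → (if Bool.not ⌊ d ⌋ then x else 0ℤ) ≡ (¬? d) ⊙ x
  if-not (yes _) x = refl
  if-not (no _) x = refl

open Sums

-- Rank calculus for flats and modular flats of a restriction

module Flats {n} (M : Matroid n) (loopless : ∀ e → Matroid.r M ⁅ e ⁆ ≡ 1) where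

  open import Data.Nat.Base using (_+_)
  open import Data.Fin.Subset using (_-_)
  open Matroid M
  open +-*-Solver using (solve; _:=_; _:+_)

  private
    variable
      A B C E F G S T X Y Z : Subset n

  ∪-lub : A ⊆ C → B ⊆ C → A ∪ B ⊆ C
  ∪-lub {A = A} {B = B} f g x∈ = [ f , g ] (x∈p∪q⁻ A B x∈)

  ∪-mono : A ⊆ C → B ⊆ E → A ∪ B ⊆ C ∪ E
  ∪-mono f g = ∪-lub (λ x∈ → x∈p∪q⁺ (inj₁ (f x∈))) (λ x∈ → x∈p∪q⁺ (inj₂ (g x∈)))

  ∩-glb : C ⊆ A → C ⊆ B → C ⊆ A ∩ B
  ∩-glb f g x∈ = x∈p∩q⁺ (f x∈ , g x∈)

  ∩-mono : A ⊆ C → B ⊆ E → A ∩ B ⊆ C ∩ E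
  ∩-mono {A = A} {B = B} f g = ∩-glb (λ x∈ → f (p∩q⊆p A B x∈)) (λ x∈ → g (p∩q⊆q A B x∈))

  ⁅⁆-⊆ : ∀ {e} → e ∈ A → ⁅ e ⁆ ⊆ A
  ⁅⁆-⊆ {e = e} e∈ x∈ with refl ← x∈⁅y⁆⇒x≡y e x∈ = e∈

  inl : A ⊆ A ∪ B
  inl {B = B} = p⊆p∪q B

  inr : B ⊆ A ∪ B
  inr {B = B} {A = A} = q⊆p∪q A B

  fst∩ : A ∩ B ⊆ A
  fst∩ {A = A} {B = B} = p∩q⊆p A B

  snd∩ : A ∩ B ⊆ B
  snd∩ {A = A} {B = B} = p∩q⊆q A B

  -- Linear arithmetic over ℕ without subtraction: l ≤ u is the sum of all hypotheses, and the equation is left to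
  -- the ring solver.
  ≤-by : ∀ {a b l u} → l ≤ u → a + u ≡ b + l → a ≤ b
  ≤-by {a} {b} {l} {u} l≤u eq =
    ℕₚ.+-cancelʳ-≤ u a b (ℕₚ.≤-trans (ℕₚ.≤-reflexive eq) (ℕₚ.+-monoʳ-≤ b l≤u))

  infixl 6 _⊕_
  _⊕_ : ∀ {a b c d} → a ≤ b → c ≤ d → a + c ≤ b + d
  _⊕_ = ℕₚ.+-mono-≤

  mono : X ⊆ Y → r X ≤ r Y
  mono = r-mono _ _

  submod : ∀ X Y → Z ⊆ X ∪ Y → T ⊆ X ∩ Y → r Z + r T ≤ r X + r Y
  submod X Y f g = ℕₚ.≤-trans (mono f ⊕ mono g) (r-submod X Y)

  r-⊥ : r ⊥ ≡ 0
  r-⊥ = ℕₚ.n≤0⇒n≡0 (ℕₚ.≤-trans (r-card ⊥) (ℕₚ.≤-reflexive (∣⊥∣≡0 n)))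

  rank0-empty : ∀ {e} → r S ≡ 0 → e ∉ S
  rank0-empty {S = S} {e = e} eq e∈ =
    ℕₚ.1+n≰n (subst (_≤ 0) (loopless e) (ℕₚ.≤-trans (mono (⁅⁆-⊆ e∈)) (ℕₚ.≤-reflexive eq)))

  rank≢0-nonempty : r S ≢ 0 → Nonempty S
  rank≢0-nonempty {S = S} ≢0 with nonempty? S
  ... | yes ne = ne
  ... | no empty = ⊥-elim (≢0 (trans (cong r (Empty-unique empty)) r-⊥))

  disjoint : ∀ {e} → r (A ∩ B) ≡ 0 → e ∈ A → e ∉ B
  disjoint eq e∈A e∈B = rank0-empty eq (x∈p∩q⁺ (e∈A , e∈B))

  disjoint-mono : A ∩ B ⊆ C → r C ≡ 0 → r (A ∩ B) ≡ 0
  disjoint-mono f eq = ℕₚ.n≤0⇒n≡0 (ℕₚ.≤-trans (mono f) (ℕₚ.≤-reflexive eq))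

  -- Diminishing returns: submodularity for `B` and `A ∪ S`, whose intersection contains `A`.
  absorb : A ⊆ B → r (A ∪ S) ≤ r A → r (B ∪ S) ≤ r B
  absorb {A = A} {B = B} {S = S} A⊆B h = ≤-by
    (submod {Z = B ∪ S} {T = A} B (A ∪ S) (∪-mono (λ x → x) inr) (∩-glb A⊆B inl) ⊕ h)
    (solve 4 (λ a b bs as → bs :+ (b :+ as :+ a) := b :+ (bs :+ a :+ as))
       refl (r A) (r B) (r (B ∪ S)) (r (A ∪ S)))

  r-∪⁅⁆ : ∀ X e → r (X ∪ ⁅ e ⁆) ≤ suc (r X)
  r-∪⁅⁆ X e = ℕₚ.≤-trans (ℕₚ.m≤m+n _ _) (ℕₚ.≤-trans (r-submod X ⁅ e ⁆)
    (ℕₚ.≤-reflexive (trans (cong (r X +_) (loopless e)) (ℕₚ.+-comm (r X) 1))))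

  -- Elements of `S` are removed one at a time; by `absorb`, an element that adds no rank to `X`
  -- adds none to a larger set. The bound `k` on the size of `S` drives the recursion.
  spanned : (∀ {e} → e ∈ S → r (X ∪ ⁅ e ⁆) ≤ r X) → r (X ∪ S) ≤ r X
  spanned {S = S₀} {X = X} = go _ S₀ ℕₚ.≤-refl
    where
    go : ∀ k S → ∣ S ∣ ≤ k → (∀ {e} → e ∈ S → r (X ∪ ⁅ e ⁆) ≤ r X) → r (X ∪ S) ≤ r X
    go k S le h with nonempty? S
    ... | no empty = mono (∪-lub (λ x → x) (λ x∈ → ⊥-elim (empty (_ , x∈))))
    go zero S le h | yes (e , e∈) = ⊥-elim (ℕₚ.1+n≰n (ℕₚ.≤-trans (ℕₚ.≤-trans (s≤s z≤n) (x∈p⇒∣p-x∣<∣p∣ e∈)) le))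
    go (suc k) S le h | yes (e , e∈) =
      ℕₚ.≤-trans (mono cover) (ℕₚ.≤-trans (absorb inl (h e∈))
        (go k (S - e) (s≤s⁻¹ (ℕₚ.≤-trans (x∈p⇒∣p-x∣<∣p∣ e∈) le)) (λ x∈ → h (p─q⊆p S ⁅ e ⁆ x∈))))
      where
      cover : X ∪ S ⊆ (X ∪ (S - e)) ∪ ⁅ e ⁆
      cover = ∪-lub (λ x∈ → inl (inl x∈)) λ {x} x∈ → split x x∈
        where
        split : ∀ x → x ∈ S → x ∈ (X ∪ (S - e)) ∪ ⁅ e ⁆
        split x x∈ with x ∈? ⁅ e ⁆
        ... | yes x∈e = inr x∈e
        ... | no x∉e = inl (inr (x∈p∧x≢y⇒x∈p-y x∈ (x∉⁅y⁆⇒x≢y x∉e)))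

  -- Closedness is stated as an inequality of ranks, so that bounds obtained from submodularity
  -- yield membership directly.
  record IsFlat (E X : Subset n) : Set where
    constructor mkFlat
    field
      ⊆-ground : X ⊆ E
      closed   : ∀ {e} → e ∈ E → r (X ∪ ⁅ e ⁆) ≤ r X → e ∈ X

  open IsFlat

  flat-absorbs : IsFlat E X → S ⊆ E → r (X ∪ S) ≤ r X → S ⊆ X
  flat-absorbs fX S⊆E h x∈ =
    closed fX (S⊆E x∈) (ℕₚ.≤-trans (mono (∪-mono (λ y → y) (⁅⁆-⊆ x∈))) h)

  flat-spanned : IsFlat E X → A ⊆ X → S ⊆ E → r (A ∪ S) ≤ r A → S ⊆ X
  flat-spanned fX A⊆X S⊆E h = flat-absorbs fX S⊆E (absorb A⊆X h)

  flat-max : IsFlat E A → A ⊆ B → B ⊆ E → r B ≤ r A → B ⊆ A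
  flat-max fA A⊆B B⊆E h = flat-absorbs fA B⊆E (ℕₚ.≤-trans (mono (∪-lub A⊆B (λ x → x))) h)

  flat-∩ : IsFlat E X → IsFlat E Y → IsFlat E (X ∩ Y)
  flat-∩ {X = X} {Y = Y} fX fY = mkFlat (λ x → ⊆-ground fX (fst∩ x))
    λ e∈E h → x∈p∩q⁺ (closed fX e∈E (absorb fst∩ h) , closed fY e∈E (absorb (snd∩ {A = X}) h))

  flat-restrict : F ⊆ E → Z ⊆ F → IsFlat E Z → IsFlat F Z
  flat-restrict F⊆E Z⊆F fZ = mkFlat Z⊆F λ e∈F → closed fZ (F⊆E e∈F)

  flat-extend : IsFlat E F → IsFlat F Z → IsFlat E Z
  flat-extend fF fZ = mkFlat (λ x → ⊆-ground fF (⊆-ground fZ x))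
    λ e∈E h → closed fZ (closed fF e∈E (absorb (⊆-ground fZ) h)) h

  flat-ground : IsFlat E E
  flat-ground = mkFlat (λ x → x) (λ e∈E _ → e∈E)

  flat-⊥ : IsFlat E ⊥
  flat-⊥ {E = E} = mkFlat (⊆-min _)
    λ {e} _ h → ⊥-elim (rank0-empty {e = e} (ℕₚ.n≤0⇒n≡0 (ℕₚ.≤-trans h (ℕₚ.≤-reflexive r-⊥))) (inr (x∈⁅x⁆ e)))

  ∈cl⁻ : ∀ {e} → e ∈ cl M E X → e ∈ E × r (X ∪ ⁅ e ⁆) ≡ r X
  ∈cl⁻ {E = E} {X = X} {e = e} e∈
    with trans (sym (lookup∘tabulate _ e)) ([]=⇒lookup e∈)
  ... | eq with lookup E e in eqE | r (X ∪ ⁅ e ⁆) ℕₚ.≟ r X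
  ...   | true | yes rr = lookup⇒[]= e E eqE , rr
  ...   | true | no _ = ⊥-elim (Boolₚ.not-¬ refl (sym eq))
  ...   | false | _ = ⊥-elim (Boolₚ.not-¬ refl (sym eq))

  ∈cl⁺ : ∀ {e} → e ∈ E → r (X ∪ ⁅ e ⁆) ≡ r X → e ∈ cl M E X
  ∈cl⁺ {E = E} {X = X} {e = e} e∈E rr = lookup⇒[]= e _ (trans (lookup∘tabulate _ e) bits)
    where
    bits : lookup E e Bool.∧ ⌊ r (X ∪ ⁅ e ⁆) ℕₚ.≟ r X ⌋ ≡ true
    bits with lookup E e | []=⇒lookup e∈E | r (X ∪ ⁅ e ⁆) ℕₚ.≟ r X
    ... | .true | refl | yes _ = refl
    ... | .true | refl | no ¬rr = ⊥-elim (¬rr rr)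

  cl-⊆ : cl M E X ⊆ E
  cl-⊆ {E = E} x∈ = proj₁ (∈cl⁻ {E = E} x∈)

  ⊆-cl : X ⊆ E → X ⊆ cl M E X
  ⊆-cl {E = E} X⊆E x∈ = ∈cl⁺ {E = E} (X⊆E x∈)
    (ℕₚ.≤-antisym (mono (∪-lub (λ y → y) (⁅⁆-⊆ x∈))) (mono inl))

  r-∪cl : r (X ∪ cl M E X) ≤ r X
  r-∪cl {E = E} = spanned (λ e∈ → ℕₚ.≤-reflexive (proj₂ (∈cl⁻ {E = E} e∈)))

  r-cl : X ⊆ E → r (cl M E X) ≡ r X
  r-cl {X = X} {E = E} X⊆E = ℕₚ.≤-antisym (ℕₚ.≤-trans (mono (inr {A = X})) (r-∪cl {E = E})) (mono (⊆-cl X⊆E))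

  cl-flat : X ⊆ E → IsFlat E (cl M E X)
  cl-flat {X = X} {E = E} X⊆E = mkFlat cl-⊆ λ {e} e∈E h → ∈cl⁺ {E = E} e∈E (ℕₚ.≤-antisym
    (ℕₚ.≤-trans (mono (∪-mono (⊆-cl X⊆E) (λ x → x))) (ℕₚ.≤-trans h (ℕₚ.≤-reflexive (r-cl X⊆E))))
    (mono inl))

  cl-least : IsFlat E Z → X ⊆ Z → cl M E X ⊆ Z
  cl-least {E = E} fZ X⊆Z = flat-spanned fZ X⊆Z cl-⊆ (r-∪cl {E = E})

  IsFlat⇒Flat : IsFlat E X → Flat M E X
  IsFlat⇒Flat fX = ⊆-antisym (cl-least fX (λ x → x)) (⊆-cl (⊆-ground fX))

  Flat⇒IsFlat : Flat M E X → IsFlat E X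
  Flat⇒IsFlat {E = E} {X = X} eq = mkFlat X⊆E
    λ e∈E h → subst (_ ∈_) eq (∈cl⁺ {E = E} e∈E (ℕₚ.≤-antisym h (mono inl)))
    where
    X⊆E : X ⊆ E
    X⊆E x∈ = cl-⊆ (subst (_ ∈_) (sym eq) x∈)

  isFlat? : ∀ E X → Dec (IsFlat E X)
  isFlat? E X = map′ Flat⇒IsFlat IsFlat⇒Flat (cl M E X ≟S X)

  -- Only one inequality is recorded, since submodularity is the other. The union replaces the join
  -- because closure preserves rank.
  record IsModular (E F : Subset n) : Set where
    constructor mkModular
    field
      flat    : IsFlat E F
      modular : IsFlat E Y → r F + r Y ≤ r (F ∩ Y) + r (F ∪ Y)

  open IsModular

  Modular⇒IsModular : Modular M E F → IsModular E F
  Modular⇒IsModular (fF , eq) = mkModular fF′ λ fY → ℕₚ.≤-reflexive (trans (eq _ (IsFlat⇒Flat fY))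
    (cong (r _ +_) (r-cl (∪-lub (⊆-ground fF′) (⊆-ground fY)))))
    where fF′ = Flat⇒IsFlat fF

  modular-ground : IsModular E E
  modular-ground = mkModular flat-ground λ {Y} fY →
    ℕₚ.≤-trans (ℕₚ.≤-reflexive (ℕₚ.+-comm _ (r Y))) (mono (∩-glb (⊆-ground fY) (λ x → x)) ⊕ mono inl)

  modular-⊥ : IsModular E ⊥
  modular-⊥ = mkModular flat-⊥ λ {Y} _ → mono (⊆-min _) ⊕ mono inr

  modular-restrict : IsModular E X → IsFlat E G → X ⊆ G → IsModular G X
  modular-restrict mX fG X⊆G = mkModular (flat-restrict (⊆-ground fG) X⊆G (flat mX))
    λ fY → modular mX (flat-extend fG fY)

  -- For `Y` inside `G`, the sets `F ∩ Y` and `(F ∩ G) ∩ Y` agree. The rank of `(F ∩ G) ∪ Y` is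
  -- bounded below by submodularity against `F`, as their union contains `F ∪ Y`.
  modular-∩ : IsModular E F → IsFlat E G → IsModular G (F ∩ G)
  modular-∩ {F = F} {G = G} mF fG =
    mkModular (flat-restrict (⊆-ground fG) snd∩ (flat-∩ (flat mF) fG)) λ {Y} fY → ≤-by
    (submod {Z = F ∪ Y} {T = F ∩ G} F ((F ∩ G) ∪ Y) (∪-mono (λ x → x) inr) (∩-glb fst∩ inl)
      ⊕ modular mF (flat-extend fG fY)
      ⊕ mono {X = F ∩ Y} {Y = (F ∩ G) ∩ Y} (∩-glb (∩-mono (λ x → x) (⊆-ground fY)) snd∩))
    (solve 7 (λ f y x fy xy fuy xuy →
       (x :+ y) :+ (f :+ xuy :+ (fy :+ fuy) :+ xy) := (xy :+ xuy) :+ (fuy :+ x :+ (f :+ y) :+ fy))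
       refl (r F) (r Y) (r (F ∩ G)) (r (F ∩ Y)) (r ((F ∩ G) ∩ Y)) (r (F ∪ Y)) (r ((F ∩ G) ∪ Y)))

  -- Combines modularity of `F` against `Y` with that of `X` against `F ∩ Y`; submodularity for `F`
  -- and `X ∪ Y` links the two.
  modular-trans : IsModular F X → IsModular E F → IsModular E X
  modular-trans {F = F} {X = X} mX mF = mkModular (flat-extend (flat mF) (flat mX)) λ {Y} fY → ≤-by
    (submod {Z = F ∪ Y} {T = X ∪ (F ∩ Y)} F (X ∪ Y) (∪-mono (λ x → x) inr)
       (∪-lub (∩-glb (⊆-ground (flat mX)) inl) (∩-mono (λ x → x) inr))
      ⊕ modular mF fY
      ⊕ modular mX (flat-restrict (⊆-ground (flat mF)) fst∩ (flat-∩ (flat mF) fY))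
      ⊕ mono {X = X ∩ (F ∩ Y)} {Y = X ∩ Y} (∩-mono (λ x → x) snd∩))
    (solve 9 (λ f y x fy xfy xy fuy xufy xuy →
       (x :+ y) :+ (f :+ xuy :+ (fy :+ fuy) :+ (xfy :+ xufy) :+ xy)
         := (xy :+ xuy) :+ (fuy :+ xufy :+ (f :+ y) :+ (x :+ fy) :+ xfy))
       refl (r F) (r Y) (r X) (r (F ∩ Y)) (r (X ∩ (F ∩ Y))) (r (X ∩ Y)) (r (F ∪ Y)) (r (X ∪ (F ∩ Y))) (r (X ∪ Y)))

  modular-skew : IsModular E F → IsFlat E Z → r (Z ∩ F) ≡ 0 → r F + r Z ≤ r (F ∪ Z)
  modular-skew {F = F} {Z = Z} mF fZ eq = ℕₚ.≤-trans (modular mF fZ)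
    (ℕₚ.≤-reflexive (cong (_+ r (F ∪ Z)) (trans (cong r (∩-comm F Z)) eq)))

  modular-⊕ : IsModular E F → IsFlat E Z → r (Z ∩ F) ≡ 0 → A ⊆ F → r A + r Z ≤ r (A ∪ Z)
  modular-⊕ {F = F} {Z = Z} {A = A} mF fZ eq A⊆F = ≤-by
    (submod {Z = F ∪ Z} {T = A} F (A ∪ Z) (∪-mono (λ x → x) inr) (∩-glb A⊆F inl)
      ⊕ modular-skew mF fZ eq)
    (solve 5 (λ f z a fz az → (a :+ z) :+ (f :+ az :+ fz) := az :+ (fz :+ a :+ (f :+ z)))
       refl (r F) (r Z) (r A) _ _)

  r-modular-⊕ : IsModular E F → IsFlat E Z → r (Z ∩ F) ≡ 0 → A ⊆ F → r (A ∪ Z) ≡ r A + r Z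
  r-modular-⊕ {Z = Z} {A = A} mF fZ eq A⊆F = ℕₚ.≤-antisym
    (ℕₚ.≤-trans (ℕₚ.m≤m+n _ _) (r-submod A Z)) (modular-⊕ mF fZ eq A⊆F)

  -- The modular law for `A ⊆ F`: submodularity for `F` and the join, together with skewness of `F`
  -- and `Z`, leaves rank at most `r A` for the intersection, and the flat `A` is maximal of its
  -- rank.
  cl-∪-∩ : IsModular E F → IsFlat E Z → r (Z ∩ F) ≡ 0 → IsFlat E A → A ⊆ F →
           cl M E (A ∪ Z) ∩ F ⊆ A
  cl-∪-∩ {E = E} {F = F} {Z = Z} {A = A} mF fZ eq fA A⊆F =
    flat-max fA (∩-glb (λ x → A∪Z⊆W (inl x)) A⊆F) (λ x → ⊆-ground (flat mF) (snd∩ x)) (≤-by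
      (submod {Z = F ∪ Z} {T = W ∩ F} F W (∪-mono (λ x → x) (λ x → A∪Z⊆W (inr x))) (∩-glb snd∩ fst∩)
        ⊕ modular-skew mF fZ eq
        ⊕ ℕₚ.≤-reflexive (trans (r-cl A∪Z⊆E) (r-modular-⊕ mF fZ eq A⊆F)))
      (solve 6 (λ f z a fz t tf → tf :+ (f :+ t :+ fz :+ (a :+ z)) := a :+ (fz :+ tf :+ (f :+ z) :+ t))
         refl (r F) (r Z) (r A) (r (F ∪ Z)) (r W) (r (W ∩ F))))
    where
    W = cl M E (A ∪ Z)
    A∪Z⊆E : A ∪ Z ⊆ E
    A∪Z⊆E = ∪-lub (⊆-ground fA) (⊆-ground fZ)
    A∪Z⊆W : A ∪ Z ⊆ W
    A∪Z⊆W = ⊆-cl A∪Z⊆E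

  -- Steinitz exchange: `Y ∪ ⁅ y ⁆` already has the rank of `Y ∪ ⁅ x ⁆`, so `x` adds nothing to it.
  exchange : ∀ {x y} → IsFlat E Y → IsFlat E T → Y ⊆ T → x ∈ E → y ∈ cl M E (Y ∪ ⁅ x ⁆) → y ∉ Y → y ∈ T → x ∈ T
  exchange {E = E} {Y = Y} {T = T} {x = x} {y = y} fY fT Y⊆T x∈E y∈cl y∉Y y∈T =
    flat-spanned fT (∪-lub Y⊆T (⁅⁆-⊆ y∈T)) (⁅⁆-⊆ x∈E) h (x∈⁅x⁆ x)
    where
    h : r ((Y ∪ ⁅ y ⁆) ∪ ⁅ x ⁆) ≤ r (Y ∪ ⁅ y ⁆)
    h = ℕₚ.≤-trans (mono (∪-lub (∪-lub (λ z → inl (inl z)) inr) (λ z → inl (inr z))))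
      (ℕₚ.≤-trans (ℕₚ.≤-reflexive (proj₂ (∈cl⁻ {E = E} y∈cl)))
      (ℕₚ.≤-trans (r-∪⁅⁆ Y x) (ℕₚ.≰⇒> (λ le → y∉Y (closed fY (cl-⊆ y∈cl) le)))))

-- Möbius function of the lattice of flats

module Möbius {n} (M : Matroid n) (loopless : ∀ e → Matroid.r M ⁅ e ⁆ ≡ 1) where

  open Flats M loopless
  open import Data.Integer.Base using (_+_; _*_; -_; _-_)
  open Matroid M
  open IsFlat
  open IsModular
  open Algebra.Properties.AbelianGroup ℤₚ.+-0-abelianGroup using (∙-cancelʳ)

  private
    variable
      E F X Y Z : Subset n

  ⊈-witness : ¬ (Y ⊆ Z) → ∃ λ x → x ∈ Y × x ∉ Z
  ⊈-witness {Y = Y} {Z = Z} Y⊈Z with Finₚ.any? (λ x → (x ∈? Y) ×-dec ¬? (x ∈? Z))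
  ... | yes w = w
  ... | no ∄ = ⊥-elim (Y⊈Z λ {x} → member x)
    where
    member : ∀ x → x ∈ Y → x ∈ Z
    member x x∈Y with x ∈? Z
    ... | yes x∈Z = x∈Z
    ... | no x∉Z = ⊥-elim (∄ (x , x∈Y , x∉Z))

  ⊆∧≢⇒∣∣< : Z ⊆ Y → Z ≢ Y → ∣ Z ∣ < ∣ Y ∣
  ⊆∧≢⇒∣∣< Z⊆Y Z≢Y = p⊂q⇒∣p∣<∣q∣ (Z⊆Y , ⊈-witness (λ Y⊆Z → Z≢Y (⊆-antisym Z⊆Y Y⊆Z)))

  Interval : (E X Y Z : Subset n) → Set
  Interval E X Y Z = IsFlat E Z × X ⊆ Z × Z ⊆ Y

  interval? : ∀ E X Y Z → Dec (Interval E X Y Z)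
  interval? E X Y Z = isFlat? E Z ×-dec (X ⊆? Z) ×-dec (Z ⊆? Y)

  HalfOpen : (E X Y Z : Subset n) → Set
  HalfOpen E X Y Z = Interval E X Y Z × Z ≢ Y

  halfOpen? : ∀ E X Y Z → Dec (HalfOpen E X Y Z)
  halfOpen? E X Y Z = interval? E X Y Z ×-dec ¬? (Z ≟S Y)

  μ′-unfold : ∀ E k X Y → μ' M E (suc k) X Y ≡
    (if ⌊ Y ≟S X ⌋ then 1ℤ else - ∑ (λ Z → halfOpen? E X Y Z ⊙ μ' M E k X Z))
  μ′-unfold E k X Y = cong (λ s → if ⌊ Y ≟S X ⌋ then 1ℤ else - s)
    (trans (sumℤ-allSubsets _) (∑-cong λ Z → brackets Z (μ' M E k X Z)))
    where
    brackets : ∀ Z x → (if isFlat M E Z Bool.∧ ⌊ X ⊆? Z ⌋ Bool.∧ ⌊ Z ⊆? Y ⌋ Bool.∧ Bool.not ⌊ Z ≟S Y ⌋ then x else 0ℤ)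
                       ≡ halfOpen? E X Y Z ⊙ x
    brackets Z x = trans (if-∧ (cl M E Z ≟S Z) _ x)
      (trans (⊙-congʳ (cl M E Z ≟S Z) λ _ → trans (if-∧ (X ⊆? Z) _ x)
             (⊙-congʳ (X ⊆? Z) λ _ → trans (if-∧ (Z ⊆? Y) _ x)
             (⊙-congʳ (Z ⊆? Y) λ _ → if-not (Z ≟S Y) x)))
      (trans (⊙-congʳ (cl M E Z ≟S Z) λ _ →
             trans (⊙-congʳ (X ⊆? Z) λ _ → ⊙-× (Z ⊆? Y) (¬? (Z ≟S Y)) x) (⊙-× (X ⊆? Z) ((Z ⊆? Y) ×-dec ¬? (Z ≟S Y)) x))
      (trans (⊙-× (cl M E Z ≟S Z) ((X ⊆? Z) ×-dec (Z ⊆? Y) ×-dec ¬? (Z ≟S Y)) x)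
      (⊙-cong ((cl M E Z ≟S Z) ×-dec (X ⊆? Z) ×-dec (Z ⊆? Y) ×-dec ¬? (Z ≟S Y)) (halfOpen? E X Y Z)
        (λ { (f , a , b , c) → (Flat⇒IsFlat f , a , b) , c })
        (λ { ((f , a , b) , c) → IsFlat⇒Flat f , a , b , c })
        (λ _ → refl)))))

  -- The recursion passes on one unit of fuel less, whereas `μ` starts afresh from the size of its
  -- argument. Both suffice, because sizes drop strictly along proper inclusions.
  μ′-fuel : ∀ E X k l Y → ∣ Y ∣ < k → ∣ Y ∣ < l → μ' M E k X Y ≡ μ' M E l X Y
  μ′-fuel E X (suc k) (suc l) Y (s≤s Y≤k) (s≤s Y≤l) = trans (μ′-unfold E k X Y) (trans
    (cong (λ s → if ⌊ Y ≟S X ⌋ then 1ℤ else - s) (∑-cong λ Z → ⊙-congʳ (halfOpen? E X Y Z)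
      λ { ((_ , _ , Z⊆Y) , Z≢Y) → let Z<Y = ⊆∧≢⇒∣∣< Z⊆Y Z≢Y in
          μ′-fuel E X k l Z (ℕₚ.≤-trans Z<Y Y≤k) (ℕₚ.≤-trans Z<Y Y≤l) }))
    (sym (μ′-unfold E l X Y)))

  -- The flats of `F` are exactly the flats of `E` contained in `F`, so both recursions run over the
  -- same sets.
  μ′-restrict : ∀ k X Y → IsFlat E F → Y ⊆ F → μ' M F k X Y ≡ μ' M E k X Y
  μ′-restrict zero X Y fF Y⊆F = refl
  μ′-restrict {E = E} {F = F} (suc k) X Y fF Y⊆F = trans (μ′-unfold F k X Y) (trans
    (cong (λ s → if ⌊ Y ≟S X ⌋ then 1ℤ else - s) (∑-cong λ Z →
      ⊙-cong (halfOpen? F X Y Z) (halfOpen? E X Y Z)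
        (λ { ((fZ , X⊆Z , Z⊆Y) , Z≢Y) → (flat-extend fF fZ , X⊆Z , Z⊆Y) , Z≢Y })
        (λ { ((fZ , X⊆Z , Z⊆Y) , Z≢Y) →
             (flat-restrict (⊆-ground fF) (λ x → Y⊆F (Z⊆Y x)) fZ , X⊆Z , Z⊆Y) , Z≢Y })
        (λ { ((_ , _ , Z⊆Y) , _) → μ′-restrict k X Z fF (λ x → Y⊆F (Z⊆Y x)) })))
    (sym (μ′-unfold E k X Y)))

  -- Opaque, so that unification does not unfold the recursion defining μ.
  abstract

    mob : (E X Y : Subset n) → ℤ
    mob E X Y = μ M E X Y

    mob≡μ : ∀ E X Y → mob E X Y ≡ μ M E X Y
    mob≡μ E X Y = refl

    mob-restrict : IsFlat E F → Y ⊆ F → mob F X Y ≡ mob E X Y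
    mob-restrict {Y = Y} {X = X} fF Y⊆F = μ′-restrict (suc ∣ Y ∣) X Y fF Y⊆F

    mob-refl : ∀ E X → mob E X X ≡ 1ℤ
    mob-refl E X with X ≟S X
    ... | yes _ = refl
    ... | no X≢X = ⊥-elim (X≢X refl)

    mob-unfold : X ≢ Y → mob E X Y ≡ - ∑ (λ Z → halfOpen? E X Y Z ⊙ mob E X Z)
    mob-unfold {X = X} {Y = Y} {E = E} X≢Y = trans (μ′-unfold E ∣ Y ∣ X Y) (trans drop-if
      (cong -_ (∑-cong λ Z → ⊙-congʳ (halfOpen? E X Y Z) λ { ((_ , _ , Z⊆Y) , Z≢Y) →
        μ′-fuel E X _ _ Z (⊆∧≢⇒∣∣< Z⊆Y Z≢Y) ℕₚ.≤-refl })))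
      where
      drop-if : ∀ {s} → (if ⌊ Y ≟S X ⌋ then 1ℤ else s) ≡ s
      drop-if with Y ≟S X
      ... | yes Y≡X = ⊥-elim (X≢Y (sym Y≡X))
      ... | no _ = refl

  ∑-interval-top : IsFlat E Y → X ⊆ Y → ∀ (f : Subset n → ℤ) →
    ∑ (λ Z → interval? E X Y Z ⊙ f Z) ≡ f Y + ∑ (λ Z → halfOpen? E X Y Z ⊙ f Z)
  ∑-interval-top {E = E} {Y = Y} {X = X} fY X⊆Y f = begin
    ∑ (λ Z → interval? E X Y Z ⊙ f Z)
      ≡⟨ ∑-cong (λ Z → ⊙-split (interval? E X Y Z) (Z ≟S Y) (f Z)) ⟩
    ∑ (λ Z → (interval? E X Y Z ×-dec (Z ≟S Y)) ⊙ f Z + halfOpen? E X Y Z ⊙ f Z)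
      ≡⟨ ∑-+ _ _ ⟩
    ∑ (λ Z → (interval? E X Y Z ×-dec (Z ≟S Y)) ⊙ f Z) + ∑ (λ Z → halfOpen? E X Y Z ⊙ f Z)
      ≡⟨ cong (_+ ∑ (λ Z → halfOpen? E X Y Z ⊙ f Z)) (trans (∑-cong λ Z → ⊙-cong (interval? E X Y Z ×-dec (Z ≟S Y)) (Z ≟S Y)
           proj₂ (λ { refl → (fY , X⊆Y , λ x → x) , refl }) (λ _ → refl)) (∑-single Y f)) ⟩
    f Y + ∑ (λ Z → halfOpen? E X Y Z ⊙ f Z) ∎
    where open ≡-Reasoning

  ∑-mob : IsFlat E Y → X ⊆ Y → ∑ (λ Z → interval? E X Y Z ⊙ mob E X Z) ≡ (Y ≟S X) ⊙ 1ℤ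
  ∑-mob {E = E} {Y = Y} {X = X} fY X⊆Y = trans (∑-interval-top fY X⊆Y (mob E X)) (cases (Y ≟S X))
    where
    cases : Dec (Y ≡ X) → mob E X Y + ∑ (λ Z → halfOpen? E X Y Z ⊙ mob E X Z) ≡ (Y ≟S X) ⊙ 1ℤ
    cases (yes refl) = trans (cong₂ _+_ (mob-refl E X) (∑-zero λ Z → ⊙-no (halfOpen? E X X Z)
      (λ { ((_ , X⊆Z , Z⊆X) , Z≢X) → Z≢X (⊆-antisym Z⊆X X⊆Z) }) _)) (sym (⊙-yes (X ≟S X) refl 1ℤ))
    cases (no Y≢X) = trans (cong (_+ s) (mob-unfold (Y≢X ∘ sym)))
      (trans (ℤₚ.+-inverseˡ s) (sym (⊙-no (Y ≟S X) Y≢X 1ℤ)))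
      where s = ∑ (λ Z → halfOpen? E X Y Z ⊙ mob E X Z)

  -- The interval sums form a triangular system: each one determines the value at its top from the
  -- values below. This is how a convolution is recognised as the Möbius function.
  mob-unique : (ν : Subset n → ℤ) →
    (∀ {Y} → IsFlat E Y → X ⊆ Y → ∑ (λ Z → interval? E X Y Z ⊙ ν Z) ≡ (Y ≟S X) ⊙ 1ℤ) →
    IsFlat E Y → X ⊆ Y → ν Y ≡ mob E X Y
  mob-unique {E = E} {X = X} ν char = λ fY X⊆Y → go _ _ ℕₚ.≤-refl fY X⊆Y
    where
    go : ∀ k Y → ∣ Y ∣ < k → IsFlat E Y → X ⊆ Y → ν Y ≡ mob E X Y
    go (suc k) Y (s≤s Y≤k) fY X⊆Y = ∙-cancelʳ (∑ λ Z → halfOpen? E X Y Z ⊙ ν Z) _ _ (begin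
      ν Y + ∑ (λ Z → halfOpen? E X Y Z ⊙ ν Z)        ≡⟨ ∑-interval-top fY X⊆Y ν ⟨
      ∑ (λ Z → interval? E X Y Z ⊙ ν Z)              ≡⟨ trans (char fY X⊆Y) (sym (∑-mob fY X⊆Y)) ⟩
      ∑ (λ Z → interval? E X Y Z ⊙ mob E X Z)        ≡⟨ ∑-interval-top fY X⊆Y (mob E X) ⟩
      mob E X Y + ∑ (λ Z → halfOpen? E X Y Z ⊙ mob E X Z)
        ≡⟨ cong (mob E X Y +_) (∑-cong λ Z → ⊙-congʳ (halfOpen? E X Y Z)
           λ { ((fZ , X⊆Z , Z⊆Y) , Z≢Y) → sym (go k Z (ℕₚ.≤-trans (⊆∧≢⇒∣∣< Z⊆Y Z≢Y) Y≤k) fZ X⊆Z) }) ⟩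
      mob E X Y + ∑ (λ Z → halfOpen? E X Y Z ⊙ ν Z) ∎)
      where open ≡-Reasoning

-- Modular factorisation and the splitting of linear factors

module Factorisation {n} (M : Matroid n) (loopless : ∀ e → Matroid.r M ⁅ e ⁆ ≡ 1) where

  open Flats M loopless
  open Möbius M loopless
  open import Data.Integer.Base using (_+_; _*_; -_; _-_)
  open Matroid M
  open IsFlat
  open IsModular

  private
    variable
      A E F H S X Y Y′ Z : Subset n

  -- Disjointness is expressed as rank zero, equivalent without loops, so that it enters rank
  -- inequalities as a number.
  Skew : (E X Y Z : Subset n) → Set
  Skew E X Y Z = IsFlat E Z × Y ⊆ Z × r (Z ∩ X) ≡ 0

  skew? : ∀ E X Y Z → Dec (Skew E X Y Z)
  skew? E X Y Z = isFlat? E Z ×-dec (Y ⊆? Z) ×-dec (r (Z ∩ X) ℕₚ.≟ 0)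

  -- For h k = t ^ k this is, up to reversal, χ (M|E / Y) divided by χ (M|X) when X is modular in E and
  -- disjoint from Y.  A polynomial in t is thus treated as a linear functional on all functions h, and
  -- multiplication by t is precomposition of h with suc.
  skewSum : (E X Y : Subset n) → (ℕ → ℤ) → ℤ
  skewSum E X Y h = ∑ (λ Z → skew? E X Y Z ⊙ (mob E Y Z * h (r Z)))

  skewSum-cong : ∀ E X Y {h h′ : ℕ → ℤ} → (∀ k → k ≤ r E → h k ≡ h′ k) →
                 skewSum E X Y h ≡ skewSum E X Y h′
  skewSum-cong E X Y eq = ∑-cong λ Z → ⊙-congʳ (skew? E X Y Z)
    λ { (fZ , _) → cong (mob E Y Z *_) (eq (r Z) (mono (⊆-ground fZ))) }

  ∑∑-fibre : ∀ (φ : Subset n → Subset n → Subset n) (t : Subset n → Subset n → ℤ) (g : Subset n → ℤ) →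
    ∑ (λ S → ∑ (λ A → ∑ (λ Z → (S ≟S φ A Z) ⊙ t A Z)) * g S) ≡ ∑ (λ A → ∑ (λ Z → t A Z * g (φ A Z)))
  ∑∑-fibre φ t g = begin
    ∑ (λ S → ∑ (λ A → ∑ (λ Z → (S ≟S φ A Z) ⊙ t A Z)) * g S)
      ≡⟨ ∑-cong (λ S → trans (sym (∑-*ʳ (g S) _)) (∑-cong λ A →
           trans (sym (∑-*ʳ (g S) _)) (∑-cong λ Z → sym (⊙-*ʳ (S ≟S φ A Z) _ _)))) ⟩
    ∑ (λ S → ∑ (λ A → ∑ (λ Z → (S ≟S φ A Z) ⊙ (t A Z * g S))))
      ≡⟨ ∑-swap _ ⟩
    ∑ (λ A → ∑ (λ S → ∑ (λ Z → (S ≟S φ A Z) ⊙ (t A Z * g S))))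
      ≡⟨ ∑-cong (λ A → ∑-swap _) ⟩
    ∑ (λ A → ∑ (λ Z → ∑ (λ S → (S ≟S φ A Z) ⊙ (t A Z * g S))))
      ≡⟨ ∑-cong (λ A → ∑-cong λ Z → ∑-single (φ A Z) (λ S → t A Z * g S)) ⟩
    ∑ (λ A → ∑ (λ Z → t A Z * g (φ A Z))) ∎
    where open ≡-Reasoning

  -- Stanley's modular factorisation.  As functions of S, both μ(Y,S) and the convolution ν below sum to
  -- [ S = Y ] over the interval [Y,S]; modularity of F enters through the rank of A ∨ Z and (A ∨ Z) ∩ F = A.
  module Stanley {E F Y : Subset n} (mF : IsModular E F) (fY : IsFlat E Y) (Y∩F : r (Y ∩ F) ≡ 0) where

    Below : Subset n → Set
    Below A = IsFlat E A × A ⊆ F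

    below? : ∀ A → Dec (Below A)
    below? A = isFlat? E A ×-dec (A ⊆? F)

    pair? : ∀ A Z → Dec (Below A × Skew E F Y Z)
    pair? A Z = below? A ×-dec skew? E F Y Z

    join : Subset n → Subset n → Subset n
    join A Z = cl M E (A ∪ Z)

    weight : Subset n → Subset n → ℤ
    weight A Z = pair? A Z ⊙ (mob E ⊥ A * mob E Y Z)

    ν : Subset n → ℤ
    ν S = ∑ (λ A → ∑ (λ Z → (S ≟S join A Z) ⊙ weight A Z))

    ∪-⊆E : Below A → Skew E F Y Z → A ∪ Z ⊆ E
    ∪-⊆E (fA , _) (fZ , _) = ∪-lub (⊆-ground fA) (⊆-ground fZ)

    join-flat : Below A → Skew E F Y Z → IsFlat E (join A Z)
    join-flat bA sZ = cl-flat (∪-⊆E bA sZ)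

    ⊆-join : Below A → Skew E F Y Z → A ∪ Z ⊆ join A Z
    ⊆-join bA sZ = ⊆-cl (∪-⊆E bA sZ)

    r-join : Below A → Skew E F Y Z → r (join A Z) ≡ r A ℕ.+ r Z
    r-join bA@(fA , A⊆F) sZ@(fZ , _ , Z∩F) = trans (r-cl (∪-⊆E bA sZ)) (r-modular-⊕ mF fZ Z∩F A⊆F)

    join-∩F : Below A → Skew E F Y Z → join A Z ∩ F ⊆ A
    join-∩F (fA , A⊆F) (fZ , _ , Z∩F) = cl-∪-∩ mF fZ Z∩F fA A⊆F

    below-part : ∀ S → ∑ (λ A → interval? E ⊥ (S ∩ F) A ⊙ mob E ⊥ A) ≡ ∑ (λ A → (below? A ×-dec (A ⊆? S)) ⊙ mob E ⊥ A)
    below-part S = ∑-cong λ A → ⊙-cong (interval? E ⊥ (S ∩ F) A) (below? A ×-dec (A ⊆? S))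
      (λ { (fA , _ , A⊆) → (fA , λ x → snd∩ {A = S} (A⊆ x)) , λ x → fst∩ (A⊆ x) })
      (λ { ((fA , A⊆F) , A⊆S) → fA , ⊆-min _ , ∩-glb A⊆S A⊆F })
      (λ _ → refl)

    -- A join lies in `S` exactly when both of its parts do, so the sum is a product. The factor
    -- from `A` is the Möbius sum over `[ ⊥ , S ∩ F ]`, which vanishes unless `S` avoids `F`.
    ν-char : IsFlat E S → Y ⊆ S → ∑ (λ T → interval? E Y S T ⊙ ν T) ≡ (S ≟S Y) ⊙ 1ℤ
    ν-char {S = S} fS Y⊆S = begin
      ∑ (λ T → interval? E Y S T ⊙ ν T)
        ≡⟨ ∑-cong (λ T → trans (cong (interval? E Y S T ⊙_) (sym (ℤₚ.*-identityʳ (ν T))))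
                               (⊙-*ˡ (interval? E Y S T) (ν T) 1ℤ)) ⟩
      ∑ (λ T → ν T * (interval? E Y S T ⊙ 1ℤ))
        ≡⟨ ∑∑-fibre join weight (λ T → interval? E Y S T ⊙ 1ℤ) ⟩
      ∑ (λ A → ∑ (λ Z → weight A Z * (interval? E Y S (join A Z) ⊙ 1ℤ)))
        ≡⟨ ∑-cong (λ A → ∑-cong (split A)) ⟩
      ∑ (λ A → ∑ (λ Z → ((below? A ×-dec (A ⊆? S)) ⊙ mob E ⊥ A) * (skewIn? Z ⊙ mob E Y Z)))
        ≡⟨ trans (∑-cong (λ A → ∑-*ˡ ((below? A ×-dec (A ⊆? S)) ⊙ mob E ⊥ A) _))
                 (∑-*ʳ _ (λ A → (below? A ×-dec (A ⊆? S)) ⊙ mob E ⊥ A)) ⟩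
      ∑ (λ A → (below? A ×-dec (A ⊆? S)) ⊙ mob E ⊥ A) * ∑ (λ Z → skewIn? Z ⊙ mob E Y Z)
        ≡⟨ cong (_* ∑ (λ Z → skewIn? Z ⊙ mob E Y Z))
             (trans (sym (below-part S)) (∑-mob (flat-∩ fS (flat mF)) (⊆-min _))) ⟩
      (((S ∩ F) ≟S ⊥) ⊙ 1ℤ) * ∑ (λ Z → skewIn? Z ⊙ mob E Y Z)
        ≡⟨ finish ((S ∩ F) ≟S ⊥) ⟩
      (S ≟S Y) ⊙ 1ℤ ∎
      where
      open ≡-Reasoning
      skewIn? : ∀ Z → Dec (Skew E F Y Z × Z ⊆ S)
      skewIn? Z = skew? E F Y Z ×-dec (Z ⊆? S)
      split : ∀ A Z → weight A Z * (interval? E Y S (join A Z) ⊙ 1ℤ) ≡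
        ((below? A ×-dec (A ⊆? S)) ⊙ mob E ⊥ A) * (skewIn? Z ⊙ mob E Y Z)
      split A Z = trans (⊙-* (pair? A Z) (interval? E Y S (join A Z)) _ _)
        (trans (⊙-cong (pair? A Z ×-dec interval? E Y S (join A Z))
                       ((below? A ×-dec (A ⊆? S)) ×-dec skewIn? Z)
          (λ { ((bA , sZ) , (_ , _ , join⊆S)) → (bA , λ x → join⊆S (⊆-join bA sZ (inl x)))
                                              , (sZ , λ x → join⊆S (⊆-join bA sZ (inr x))) })
          (λ { ((bA , A⊆S) , (sZ@(_ , Y⊆Z , _) , Z⊆S)) → (bA , sZ)
             , (join-flat bA sZ , (λ x → ⊆-join bA sZ (inr (Y⊆Z x))) , cl-least fS (∪-lub A⊆S Z⊆S)) })
          (λ _ → ℤₚ.*-identityʳ _))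
        (sym (⊙-* (below? A ×-dec (A ⊆? S)) (skewIn? Z) _ _)))
      -- If `S` avoids `F`, every `Z` below it does too, and the full Möbius sum over `[ Y , S ]`
      -- remains. Otherwise `S` differs from `Y`, which avoids `F`.
      finish : (d : Dec (S ∩ F ≡ ⊥)) → (d ⊙ 1ℤ) * ∑ (λ Z → skewIn? Z ⊙ mob E Y Z) ≡ (S ≟S Y) ⊙ 1ℤ
      finish (yes S∩F) = trans (ℤₚ.*-identityˡ _) (trans
        (∑-cong λ Z → ⊙-cong (skewIn? Z) (interval? E Y S Z)
          (λ { ((fZ , Y⊆Z , _) , Z⊆S) → fZ , Y⊆Z , Z⊆S })
          (λ { (fZ , Y⊆Z , Z⊆S) → (fZ , Y⊆Z ,
               disjoint-mono (∩-mono Z⊆S (λ x → x)) (trans (cong r S∩F) r-⊥)) , Z⊆S })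
          (λ _ → refl))
        (∑-mob fS Y⊆S))
      finish (no S∩F) = sym (⊙-no (S ≟S Y)
        (λ { refl → S∩F (Empty-unique λ { (_ , x∈) → rank0-empty Y∩F x∈ }) }) 1ℤ)

    module _ {X : Subset n} (X⊆F : X ⊆ F) where

      belowSkew? : ∀ A → Dec (Below A × r (A ∩ X) ≡ 0)
      belowSkew? A = below? A ×-dec (r (A ∩ X) ℕₚ.≟ 0)

      -- Reindexes the sum over `S` by pairs `A`, `Z` with join `S`. Ranks add, so the shift by
      -- `r A` expresses a product of polynomials; the outer factor is the polynomial of `F`
      -- relative to `X`, with base `⊥`.
      factorisation : ∀ h → skewSum E X Y h ≡
        ∑ (λ A → belowSkew? A ⊙ (mob E ⊥ A * skewSum E F Y (λ k → h (r A ℕ.+ k))))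
      factorisation h = begin
        ∑ (λ S → skew? E X Y S ⊙ (mob E Y S * h (r S)))
          ≡⟨ ∑-cong (λ S → trans
               (⊙-congʳ (skew? E X Y S) λ { (fS , Y⊆S , _) →
                 cong (_* h (r S)) (sym (mob-unique ν ν-char fS Y⊆S)) })
               (⊙-*ˡ (skew? E X Y S) (ν S) (h (r S)))) ⟩
        ∑ (λ S → ν S * (skew? E X Y S ⊙ h (r S)))
          ≡⟨ ∑∑-fibre join weight (λ S → skew? E X Y S ⊙ h (r S)) ⟩
        ∑ (λ A → ∑ (λ Z → weight A Z * (skew? E X Y (join A Z) ⊙ h (r (join A Z)))))
          ≡⟨ ∑-cong (λ A → trans (∑-cong (regroup A)) (trans (∑-⊙ (belowSkew? A) _)
               (⊙-congʳ (belowSkew? A) λ _ → ∑-*ˡ (mob E ⊥ A) _))) ⟩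
        ∑ (λ A → belowSkew? A ⊙ (mob E ⊥ A * skewSum E F Y (λ k → h (r A ℕ.+ k)))) ∎
        where
        open ≡-Reasoning
        regroup : ∀ A Z → weight A Z * (skew? E X Y (join A Z) ⊙ h (r (join A Z))) ≡
          belowSkew? A ⊙ (mob E ⊥ A * (skew? E F Y Z ⊙ (mob E Y Z * h (r A ℕ.+ r Z))))
        regroup A Z = trans (⊙-* (pair? A Z) (skew? E X Y (join A Z)) _ _) (trans
          (⊙-cong (pair? A Z ×-dec skew? E X Y (join A Z)) (belowSkew? A ×-dec skew? E F Y Z)
            (λ { ((bA , sZ) , (_ , _ , join∩X)) →
                 (bA , disjoint-mono (∩-mono (λ x → ⊆-join bA sZ (inl x)) (λ x → x)) join∩X) , sZ })
            (λ { ((bA , A∩X) , sZ@(_ , Y⊆Z , _)) → (bA , sZ)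
               , (join-flat bA sZ , (λ x → ⊆-join bA sZ (inr (Y⊆Z x)))
               , disjoint-mono (∩-glb (λ x → join-∩F bA sZ (∩-mono (λ y → y) X⊆F x)) snd∩) A∩X) })
            (λ { ((bA , sZ) , _) → trans (ℤₚ.*-assoc (mob E ⊥ A) (mob E Y Z) _)
                 (cong (λ k → mob E ⊥ A * (mob E Y Z * h k)) (r-join bA sZ)) }))
          (sym (trans (cong (belowSkew? A ⊙_) (sym (⊙-*ˡ (skew? E F Y Z) (mob E ⊥ A) _)))
                      (⊙-× (belowSkew? A) (skew? E F Y Z) _))))

  -- Step says that the polynomial of Y is (1 - a t) times that of Y′, where the base Y′ has one rank more.
  defect : (E X Y Y′ : Subset n) → ℤ → (ℕ → ℤ) → ℤ
  defect E X Y Y′ a h = skewSum E X Y (h ∘ suc) - (skewSum E X Y′ h - a * skewSum E X Y′ (h ∘ suc))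

  record Step (E X Y Y′ : Subset n) (a : ℤ) : Set where
    constructor mkStep
    field
      defect≡0 : ∀ h → defect E X Y Y′ a h ≡ 0ℤ

  open Step public

  defect-cong : ∀ E X Y Y′ a {h h′ : ℕ → ℤ} → (∀ k → k ≤ suc (r E) → h k ≡ h′ k) →
                defect E X Y Y′ a h ≡ defect E X Y Y′ a h′
  defect-cong E X Y Y′ a eq = cong₂ _-_ (skewSum-cong E X Y (λ k k≤ → eq (suc k) (s≤s k≤)))
    (cong₂ _-_ (skewSum-cong E X Y′ (λ k k≤ → eq k (ℕₚ.m≤n⇒m≤1+n k≤)))
      (cong (a *_) (skewSum-cong E X Y′ (λ k k≤ → eq (suc k) (s≤s k≤)))))

  ∑-defect : ∀ {P : Subset n → Set} (P? : ∀ A → Dec (P A)) (m p q s : Subset n → ℤ) a →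
    ∑ (λ A → P? A ⊙ (m A * p A)) - (∑ (λ A → P? A ⊙ (m A * q A)) - a * ∑ (λ A → P? A ⊙ (m A * s A)))
    ≡ ∑ (λ A → P? A ⊙ (m A * (p A - (q A - a * s A))))
  ∑-defect P? m p q s a = sym (trans (∑-cong (λ A → pointwise (P? A) (m A) (p A) (q A) (s A)))
    (trans (∑-- _ _) (cong (_-_ (∑ λ A → P? A ⊙ (m A * p A)))
    (trans (∑-- _ _) (cong (_-_ (∑ λ A → P? A ⊙ (m A * q A))) (∑-*ˡ a _))))))
    where
    expand : ∀ m p q s a → m * (p - (q - a * s)) ≡ m * p - (m * q - a * (m * s))
    expand = solve-∀
    vanish : ∀ a → 0ℤ ≡ 0ℤ - (0ℤ - a * 0ℤ)
    vanish = solve-∀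
    pointwise : ∀ {P : Set} (d : Dec P) m p q s →
      d ⊙ (m * (p - (q - a * s))) ≡ d ⊙ (m * p) - (d ⊙ (m * q) - a * (d ⊙ (m * s)))
    pointwise (yes _) m p q s = expand m p q s a
    pointwise (no _) m p q s = vanish a

  -- The outer weights of `factorisation` are the same for `Y` and `Y′`, so the linear combination
  -- passes to the inner sums.
  defect-factorisation : (mF : IsModular E F) (fY : IsFlat E Y) (Y∩F : r (Y ∩ F) ≡ 0) →
    IsFlat E Y′ → r (Y′ ∩ F) ≡ 0 → (X⊆F : X ⊆ F) → ∀ a h →
    defect E X Y Y′ a h ≡
    ∑ (λ A → Stanley.belowSkew? mF fY Y∩F X⊆F A ⊙ (mob E ⊥ A * defect E F Y Y′ a (λ k → h (r A ℕ.+ k))))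
  defect-factorisation {E = E} {F = F} {Y = Y} {Y′ = Y′} mF fY Y∩F fY′ Y′∩F X⊆F a h = trans
    (cong₂ _-_ (trans (S.factorisation X⊆F (h ∘ suc)) (∑-cong λ A → shift A Y))
      (cong₂ _-_ (S′.factorisation X⊆F h)
        (cong (a *_) (trans (S′.factorisation X⊆F (h ∘ suc)) (∑-cong λ A → shift A Y′)))))
    (∑-defect (S.belowSkew? X⊆F) (mob E ⊥)
      (λ A → skewSum E F Y (λ k → h (r A ℕ.+ suc k))) (λ A → skewSum E F Y′ (λ k → h (r A ℕ.+ k)))
      (λ A → skewSum E F Y′ (λ k → h (r A ℕ.+ suc k))) a)
    where
    module S = Stanley mF fY Y∩F
    module S′ = Stanley mF fY′ Y′∩F
    shift : ∀ A Y → S.belowSkew? X⊆F A ⊙ (mob E ⊥ A * skewSum E F Y (λ k → h (suc (r A ℕ.+ k)))) ≡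
                    S.belowSkew? X⊆F A ⊙ (mob E ⊥ A * skewSum E F Y (λ k → h (r A ℕ.+ suc k)))
    shift A Y = cong (λ s → S.belowSkew? X⊆F A ⊙ (mob E ⊥ A * s))
      (skewSum-cong E F Y (λ k _ → cong h (sym (ℕₚ.+-suc (r A) k))))

  -- The defect relative to `X` is a combination of defects relative to `F` at shifted test
  -- functions, each of which vanishes.
  step-mono : IsModular E F → IsFlat E Y → r (Y ∩ F) ≡ 0 → IsFlat E Y′ → r (Y′ ∩ F) ≡ 0 → X ⊆ F →
              ∀ {a} → Step E F Y Y′ a → Step E X Y Y′ a
  step-mono {E = E} mF fY Y∩F fY′ Y′∩F X⊆F {a} st = mkStep λ h →
    trans (defect-factorisation mF fY Y∩F fY′ Y′∩F X⊆F a h)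
    (∑-zero λ A → let d = Stanley.belowSkew? mF fY Y∩F X⊆F A in
      trans (cong (λ s → d ⊙ (mob E ⊥ A * s)) (defect≡0 st (λ k → h (r A ℕ.+ k))))
        (trans (cong (d ⊙_) (ℤₚ.*-zeroʳ (mob E ⊥ A))) (⊙-zero d)))

  -- Cancels the factor χ (M|X), whose constant term in the reversed form is 1, by induction on the support of h.
  step-cancel : IsModular E X → IsFlat E Y → r (Y ∩ X) ≡ 0 → IsFlat E Y′ → r (Y′ ∩ X) ≡ 0 →
                ∀ {a} → Step E ⊥ Y Y′ a → Step E X Y Y′ a
  step-cancel {E = E} {X = X} {Y = Y} {Y′ = Y′} mX fY Y∩X fY′ Y′∩X {a} st = mkStep λ h →
    -- Ranks up to `suc (r E)` are all that the defect sees, so `h` may be cut off there to obtain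
    -- finite support.
    trans (defect-cong E X Y Y′ a (λ k k≤ → sym (⊙-yes (k ℕₚ.≤? suc (r E)) k≤ (h k))))
          (supported (suc (suc (r E))) _ (λ k ≤k → ⊙-no (k ℕₚ.≤? suc (r E)) (ℕₚ.<⇒≱ ≤k) (h k)))
    where
    open Stanley mX fY Y∩X
    D : (ℕ → ℤ) → ℤ
    D = defect E X Y Y′ a
    D-zero : ∀ g → (∀ k → g k ≡ 0ℤ) → D g ≡ 0ℤ
    D-zero g g≡0 = trans (cong₂ _-_ (zero-sum Y (g ∘ suc) (λ k → g≡0 (suc k)))
      (cong₂ _-_ (zero-sum Y′ g g≡0) (cong (a *_) (zero-sum Y′ (g ∘ suc) (λ k → g≡0 (suc k))))))
      (vanish a)
      where
      vanish : ∀ a → 0ℤ - (0ℤ - a * 0ℤ) ≡ 0ℤ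
      vanish = solve-∀
      zero-sum : ∀ Y g → (∀ k → g k ≡ 0ℤ) → skewSum E X Y g ≡ 0ℤ
      zero-sum Y g eq = ∑-zero λ Z → trans
        (⊙-congʳ (skew? E X Y Z) λ _ → trans (cong (mob E Y Z *_) (eq (r Z))) (ℤₚ.*-zeroʳ (mob E Y Z)))
        (⊙-zero (skew? E X Y Z))
    supported : ∀ m g → (∀ k → m ≤ k → g k ≡ 0ℤ) → D g ≡ 0ℤ
    supported zero g van = D-zero g (λ k → van k z≤n)
    supported (suc m) g van = begin
      D g
        ≡⟨ ∑-single ⊥ (λ _ → D g) ⟨
      ∑ (λ A → (A ≟S ⊥) ⊙ D g)
        ≡⟨ ∑-cong (λ A → isolate A (A ≟S ⊥)) ⟩
      ∑ (λ A → belowSkew? (⊆-min X) A ⊙ (mob E ⊥ A * D (λ k → g (r A ℕ.+ k))))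
        ≡⟨ defect-factorisation mX fY Y∩X fY′ Y′∩X (⊆-min X) a g ⟨
      defect E ⊥ Y Y′ a g
        ≡⟨ defect≡0 st g ⟩
      0ℤ ∎
      where
      open ≡-Reasoning
      -- The term at `⊥` is the defect in question; every other `A` has positive rank, and its shift
      -- shortens the support of `g`.
      isolate : ∀ A → (d : Dec (A ≡ ⊥)) →
        d ⊙ D g ≡ belowSkew? (⊆-min X) A ⊙ (mob E ⊥ A * D (λ k → g (r A ℕ.+ k)))
      isolate A (yes refl) = sym (trans
        (⊙-yes (belowSkew? (⊆-min X) ⊥) ((flat-⊥ , ⊆-min X) , trans (cong r (∩-zeroˡ ⊥)) r-⊥) _)
        (trans (cong₂ _*_ (mob-refl E ⊥) (defect-cong E X Y Y′ a (λ k _ → cong (λ z → g (z ℕ.+ k)) r-⊥)))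
               (ℤₚ.*-identityˡ (D g))))
      isolate A (no A≢⊥) = sym (trans
        (⊙-congʳ (belowSkew? (⊆-min X) A) λ _ → trans
          (cong (mob E ⊥ A *_) (supported m _ λ k m≤k → van _ (ℕₚ.+-mono-≤ r-pos m≤k)))
          (ℤₚ.*-zeroʳ (mob E ⊥ A)))
        (⊙-zero (belowSkew? (⊆-min X) A)))
        where
        r-pos : 1 ≤ r A
        r-pos = ℕₚ.n≢0⇒n>0 λ rA≡0 → A≢⊥ (Empty-unique λ { (_ , x∈) → rank0-empty rA≡0 x∈ })

  -- Flats that avoid `H` have rank at most `r Y′`. So `Y′` contributes a single monomial and `Y`
  -- only two terms, in consecutive degrees. The witness `- c` counts the covers of `Y` that avoid
  -- `H`, each having Möbius value -1.
  step-hyperplane : IsModular E H → IsFlat E Y → r (Y ∩ H) ≡ 0 → IsFlat E Y′ → r (Y′ ∩ H) ≡ 0 →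
    r Y′ ≡ suc (r Y) → r Y′ ℕ.+ r H ≡ r E → ∃ λ a → Step E H Y Y′ a
  step-hyperplane {E = E} {H = H} {Y = Y} {Y′ = Y′} mH fY Y∩H fY′ Y′∩H rY′ rE = - c , mkStep λ h →
    trans (cong₂ _-_ (lower (h ∘ suc)) (cong₂ _-_ (upper h) (cong (- c *_) (upper (h ∘ suc)))))
          (trans (cong (λ k → (h (suc (r Y)) + c * h (suc (suc (r Y)))) - (h k - - c * h (suc k))) rY′)
                 (vanish (h (suc (r Y))) c (h (suc (suc (r Y))))))
    where
    vanish : ∀ x c y → (x + c * y) - (x - - c * y) ≡ 0ℤ
    vanish = solve-∀
    above? : ∀ Z → Dec (Skew E H Y Z × Z ≢ Y)
    above? Z = skew? E H Y Z ×-dec ¬? (Z ≟S Y)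
    c : ℤ
    c = ∑ (λ Z → above? Z ⊙ mob E Y Z)
    skew-rank : ∀ {B} → Skew E H B Z → r Z ≤ r Y′
    skew-rank {Z = Z} (fZ , _ , Z∩H) = ℕₚ.+-cancelʳ-≤ (r H) (r Z) (r Y′) (begin
      r Z ℕ.+ r H    ≡⟨ ℕₚ.+-comm (r Z) (r H) ⟩
      r H ℕ.+ r Z    ≤⟨ modular-skew mH fZ Z∩H ⟩
      r (H ∪ Z)      ≤⟨ mono (∪-lub (⊆-ground (flat mH)) (⊆-ground fZ)) ⟩
      r E            ≡⟨ rE ⟨
      r Y′ ℕ.+ r H   ∎)
      where open ℕₚ.≤-Reasoning
    upper : ∀ h → skewSum E H Y′ h ≡ h (r Y′)
    upper h = trans (∑-cong λ Z → ⊙-cong (skew? E H Y′ Z) (Z ≟S Y′)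
        (λ { s@(fZ , Y′⊆Z , _) → ⊆-antisym (flat-max fY′ Y′⊆Z (⊆-ground fZ) (skew-rank s)) Y′⊆Z })
        (λ { refl → fY′ , (λ x → x) , Y′∩H })
        (λ _ → refl))
      (trans (∑-single Y′ (λ Z → mob E Y′ Z * h (r Z)))
             (trans (cong (_* h (r Y′)) (mob-refl E Y′)) (ℤₚ.*-identityˡ _)))
    lower : ∀ h → skewSum E H Y h ≡ h (r Y) + c * h (suc (r Y))
    lower h = trans (∑-cong λ Z → ⊙-split (skew? E H Y Z) (Z ≟S Y) _) (trans (∑-+ _ _) (cong₂ _+_
      (trans (∑-cong λ Z → ⊙-cong (skew? E H Y Z ×-dec (Z ≟S Y)) (Z ≟S Y)
          proj₂ (λ { refl → (fY , (λ x → x) , Y∩H) , refl }) (λ _ → refl))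
        (trans (∑-single Y (λ Z → mob E Y Z * h (r Z)))
               (trans (cong (_* h (r Y)) (mob-refl E Y)) (ℤₚ.*-identityˡ _))))
      (trans (∑-cong λ Z → trans
          (⊙-congʳ (above? Z) λ { (s@(fZ , Y⊆Z , _) , Z≢Y) → cong (λ k → mob E Y Z * h k)
            (ℕₚ.≤-antisym (ℕₚ.≤-trans (skew-rank s) (ℕₚ.≤-reflexive rY′))
              (ℕₚ.≰⇒> λ le → Z≢Y (⊆-antisym (flat-max fY Y⊆Z (⊆-ground fZ) le) Y⊆Z))) })
          (⊙-*ʳ (above? Z) _ _))
        (∑-*ʳ _ _))))

-- Construction of relative flags

module Flags {n} (M : Matroid n) (loopless : ∀ e → Matroid.r M ⁅ e ⁆ ≡ 1) where

  open Flats M loopless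
  open Möbius M loopless
  open Factorisation M loopless
  open import Data.Nat.Base using (_+_)
  open Matroid M
  open IsFlat
  open IsModular
  open +-*-Solver using (solve; _:=_; _:+_)

  private
    variable
      k : ℕ
      C E E₁ E₂ F G H T W X Y Y₀ Y′ Z : Subset n

  -- A flag of flats from Y up to a complement of X, with skewSum in place of the characteristic polynomial:
  -- for X = ⊥ these are the steps of a divisional flag, and flags for restrictions can be concatenated.
  data Flag (E X : Subset n) : Subset n → Set where
    done : r Y + r X ≡ r E → Flag E X Y
    step : ∀ a → IsFlat E Y′ → Y ⊆ Y′ → r Y′ ≡ suc (r Y) → r (Y′ ∩ X) ≡ 0 →
           Step E X Y Y′ a → Flag E X Y′ → Flag E X Y

  module Transfer (fF : IsFlat E F)
    (to : ∀ {Z} → Skew F X Y₀ Z → Skew E W Y₀ Z) (from : ∀ {Z} → Skew E W Y₀ Z → Skew F X Y₀ Z) where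

    skewSum-transfer : Y₀ ⊆ Y → ∀ h → skewSum F X Y h ≡ skewSum E W Y h
    skewSum-transfer {Y = Y} Y₀⊆Y h = ∑-cong λ Z → ⊙-cong (skew? F X Y Z) (skew? E W Y Z)
      (λ { (fZ , Y⊆Z , Z∩X) → let fZ′ , _ , Z∩W = to (fZ , (λ x → Y⊆Z (Y₀⊆Y x)) , Z∩X) in fZ′ , Y⊆Z , Z∩W })
      (λ { (fZ , Y⊆Z , Z∩X) → let fZ′ , _ , Z∩W = from (fZ , (λ x → Y⊆Z (Y₀⊆Y x)) , Z∩X) in fZ′ , Y⊆Z , Z∩W })
      (λ { (fZ , _) → cong (ℤ._* h (r Z)) (mob-restrict fF (⊆-ground fZ)) })

    step-transfer : Y₀ ⊆ Y → Y₀ ⊆ Y′ → ∀ {a} → Step F X Y Y′ a → Step E W Y Y′ a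
    step-transfer Y₀⊆Y Y₀⊆Y′ {a} st = mkStep λ h → trans (sym (cong₂ ℤ._-_ (skewSum-transfer Y₀⊆Y (h ∘ suc))
      (cong₂ ℤ._-_ (skewSum-transfer Y₀⊆Y′ h) (cong (a ℤ.*_) (skewSum-transfer Y₀⊆Y′ (h ∘ suc)))))) (defect≡0 st h)

    -- Concatenation of flags: `end` replaces the final `done` by a continuation, and `weaken`
    -- passes from `W` to the smaller set `T` relative to which the combined flag is wanted.
    flag-transfer : T ⊆ W →
      (∀ {Y Y′ a} → Skew E W Y₀ Y → Skew E W Y₀ Y′ → Step E W Y Y′ a → Step E T Y Y′ a) →
      (∀ {Z} → Skew F X Y₀ Z → r Z + r X ≡ r F → Flag E T Z) →
      Skew F X Y₀ Y → Flag F X Y → Flag E T Y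
    flag-transfer T⊆W weaken end sY (done eq) = end sY eq
    flag-transfer T⊆W weaken end sY@(_ , Y₀⊆Y , _) (step {Y′ = Y′} a fY′ Y⊆Y′ rY′ Y′∩X st fl) =
      let sY′ : Skew F X Y₀ Y′
          sY′ = fY′ , (λ x → Y⊆Y′ (Y₀⊆Y x)) , Y′∩X
          fY″ , Y₀⊆Y′ , Y′∩W = to sY′
      in step a fY″ Y⊆Y′ rY′ (disjoint-mono (∩-mono (λ x → x) T⊆W) Y′∩W)
           (weaken (to sY) (to sY′) (step-transfer Y₀⊆Y Y₀⊆Y′ st))
           (flag-transfer T⊆W weaken end sY′ fl)

  -- The top `C` is separate from the ground set, so that either can shrink while the other stays.
  -- The length index is the measure for recursion on chains.
  data ModularChain (E : Subset n) : ℕ → Subset n → Set where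
    base : IsModular E C → r C ≡ 0 → ModularChain E 0 C
    ext  : IsModular E C → H ⊆ C → r C ≡ suc (r H) → ModularChain E k H → ModularChain E (suc k) C

  chain-modular : ModularChain E k C → IsModular E C
  chain-modular (base mC _) = mC
  chain-modular (ext mC _ _ _) = mC

  chain-restrict : IsFlat E F → C ⊆ F → ModularChain E k C → ModularChain F k C
  chain-restrict fF C⊆F (base mC rC) = base (modular-restrict mC fF C⊆F) rC
  chain-restrict fF C⊆F (ext mC H⊆C rC ch) =
    ext (modular-restrict mC fF C⊆F) H⊆C rC (chain-restrict fF (λ x → C⊆F (H⊆C x)) ch)

  chain-trans : IsModular E F → ModularChain F k C → ModularChain E k C
  chain-trans mF (base mC rC) = base (modular-trans mC mF) rC
  chain-trans mF (ext mC H⊆C rC ch) = ext (modular-trans mC mF) H⊆C rC (chain-trans mF ch)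

  flat-grows : ∀ {e} → IsFlat E X → e ∈ E → e ∉ X → suc (r X) ≤ r (X ∪ ⁅ e ⁆)
  flat-grows fX e∈E e∉X = ℕₚ.≰⇒> (λ le → e∉X (closed fX e∈E le))

  -- Y is a complement of the modular flat C and H is the hyperplane of C below it in the chain.
  module ChainStep (mC : IsModular G C) (mH : IsModular G H) (H⊆C : H ⊆ C) (rC : r C ≡ suc (r H))
    (fY : IsFlat G Y) (Y∩C : r (Y ∩ C) ≡ 0) (rG : r Y + r C ≡ r G)
    (mX : IsModular G X) (Y∩X : r (Y ∩ X) ≡ 0) where

    Y∩H : r (Y ∩ H) ≡ 0
    Y∩H = disjoint-mono (∩-mono (λ x → x) H⊆C) Y∩C

    ground-spanned : r G ≤ r (C ∪ Y)
    ground-spanned = ℕₚ.≤-trans (ℕₚ.≤-reflexive (trans (sym rG) (ℕₚ.+-comm (r Y) (r C))))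
      (modular-⊕ mC fY Y∩C (λ x → x))

    C-spanned : ∀ {x} → x ∈ C → x ∉ H → r ((H ∪ ⁅ x ⁆) ∪ C) ≤ r (H ∪ ⁅ x ⁆)
    C-spanned x∈C x∉H = ℕₚ.≤-trans (mono (∪-lub (∪-lub H⊆C (⁅⁆-⊆ x∈C)) (λ x → x)))
      (ℕₚ.≤-trans (ℕₚ.≤-reflexive rC) (flat-grows (flat mH) (⊆-ground (flat mC) x∈C) x∉H))

    spans-ground : ∀ {x} → x ∈ C → x ∉ H → H ⊆ T → x ∈ T → Y ⊆ T → r G ≤ r T
    spans-ground x∈C x∉H H⊆T x∈T Y⊆T = ℕₚ.≤-trans ground-spanned (ℕₚ.≤-trans
      (mono (∪-lub inr (λ y → inl (Y⊆T y))))
      (absorb (∪-lub H⊆T (⁅⁆-⊆ x∈T)) (C-spanned x∈C x∉H)))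

    adjoin : Fin n → Subset n
    adjoin x = cl M G (Y ∪ ⁅ x ⁆)

    module _ {x} (x∈G : x ∈ G) where

      ∪⊆G : Y ∪ ⁅ x ⁆ ⊆ G
      ∪⊆G = ∪-lub (⊆-ground fY) (⁅⁆-⊆ x∈G)

      adjoin-flat : IsFlat G (adjoin x)
      adjoin-flat = cl-flat ∪⊆G

      ⊆-adjoin : Y ⊆ adjoin x
      ⊆-adjoin y = ⊆-cl ∪⊆G (inl y)

      ∈-adjoin : x ∈ adjoin x
      ∈-adjoin = ⊆-cl ∪⊆G (inr (x∈⁅x⁆ x))

      r-adjoin : x ∉ Y → r (adjoin x) ≡ suc (r Y)
      r-adjoin x∉Y = trans (r-cl ∪⊆G) (ℕₚ.≤-antisym (r-∪⁅⁆ Y x) (flat-grows fY x∈G x∉Y))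

    module Contract {x} (x∈C : x ∈ C) (x∉H : x ∉ H) (x∩X : r (adjoin x ∩ X) ≡ 0)
      (rec : IsFlat G (adjoin x) → r (adjoin x ∩ H) ≡ 0 → r (adjoin x) + r H ≡ r G → Flag G X (adjoin x)) where

      x∈G : x ∈ G
      x∈G = ⊆-ground (flat mC) x∈C

      rY′ : r (adjoin x) ≡ suc (r Y)
      rY′ = r-adjoin x∈G (λ x∈Y → disjoint Y∩C x∈Y x∈C)

      rG′ : r (adjoin x) + r H ≡ r G
      rG′ = trans (cong (_+ r H) rY′) (trans (sym (ℕₚ.+-suc (r Y) (r H))) (trans (cong (r Y +_) (sym rC)) rG))

      Y′∩H : r (adjoin x ∩ H) ≡ 0
      Y′∩H = ℕₚ.n≤0⇒n≡0 (ℕₚ.+-cancelˡ-≤ (r (adjoin x ∪ H)) _ 0 (begin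
        r (adjoin x ∪ H) + r (adjoin x ∩ H)  ≤⟨ r-submod (adjoin x) H ⟩
        r (adjoin x) + r H                   ≡⟨ rG′ ⟩
        r G                                  ≤⟨ spans-ground x∈C x∉H inr (inl (∈-adjoin x∈G)) (λ y → inl (⊆-adjoin x∈G y)) ⟩
        r (adjoin x ∪ H)                     ≡⟨ ℕₚ.+-identityʳ _ ⟨
        r (adjoin x ∪ H) + 0                 ∎))
        where open ℕₚ.≤-Reasoning

      flag : Flag G X Y
      -- The factor is explicit relative to `H`, but `X` need not lie in `H`; the detour through `⊥`
      -- brings it to `X`.
      flag with step-hyperplane mH fY Y∩H (adjoin-flat x∈G) Y′∩H rY′ rG′
      ... | a , st = step a (adjoin-flat x∈G) (⊆-adjoin x∈G) rY′ x∩X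
        (step-cancel mX fY Y∩X (adjoin-flat x∈G) x∩X
          (step-mono mH fY Y∩H (adjoin-flat x∈G) Y′∩H (⊆-min H) st))
        (rec (adjoin-flat x∈G) Y′∩H rG′)

    -- If every element of C outside H meets X together with Y, then all flats above Y that avoid X lie in
    -- the hyperplane E′ = Y ∨ H, to which the ground set can be restricted.
    module Restrict (meets : ∀ {x} → x ∈ C → x ∉ H → r (adjoin x ∩ X) ≢ 0) where

      Y∪H⊆G : Y ∪ H ⊆ G
      Y∪H⊆G = ∪-lub (⊆-ground fY) (⊆-ground (flat mH))

      E′ : Subset n
      E′ = cl M G (Y ∪ H)

      fE′ : IsFlat G E′
      fE′ = cl-flat Y∪H⊆G

      Y⊆E′ : Y ⊆ E′
      Y⊆E′ y = ⊆-cl Y∪H⊆G (inl y)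

      H⊆E′ : H ⊆ E′
      H⊆E′ y = ⊆-cl Y∪H⊆G (inr y)

      rE′ : r E′ ≡ r Y + r H
      rE′ = trans (r-cl Y∪H⊆G) (trans (cong r (∪-comm Y H))
        (trans (r-modular-⊕ mH fY Y∩H (λ x → x)) (ℕₚ.+-comm (r H) (r Y))))

      rG≡ : r G ≡ suc (r E′)
      rG≡ = trans (sym rG) (trans (cong (r Y +_) rC) (trans (ℕₚ.+-suc (r Y) (r H)) (cong suc (sym rE′))))

      E′∌ : ∀ {x} → x ∈ C → x ∉ H → x ∉ E′
      E′∌ x∈C x∉H x∈E′ = ℕₚ.1+n≰n (ℕₚ.≤-trans (ℕₚ.≤-reflexive (sym rG≡)) (spans-ground x∈C x∉H H⊆E′ x∈E′ Y⊆E′))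

      fY′ : IsFlat E′ Y
      fY′ = flat-restrict (⊆-ground fE′) Y⊆E′ fY

      mX′ : IsModular E′ (X ∩ E′)
      mX′ = modular-∩ mX fE′

      Y∩X′ : r (Y ∩ (X ∩ E′)) ≡ 0
      Y∩X′ = disjoint-mono (∩-mono (λ x → x) fst∩) Y∩X

      -- Suppose `e` in `Z` lies outside `E′`. By rank, `Y ∨ e` meets the modular `C` in some `x`,
      -- and `x` is outside `H` since exchange would put `e` into `E′`. Then `Y ∨ x` lies in `Z` and
      -- meets `X`, contradicting skewness.
      in-E′ : Skew G X Y Z → Z ⊆ E′
      in-E′ {Z = Z} (fZ , Y⊆Z , Z∩X) {e} e∈Z with e ∈? E′
      ... | yes e∈E′ = e∈E′
      ... | no e∉E′ = ⊥-elim contradiction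
        where
        e∈G : e ∈ G
        e∈G = ⊆-ground fZ e∈Z
        rW : r (adjoin e) ≡ suc (r Y)
        rW = r-adjoin e∈G (λ e∈Y → e∉E′ (Y⊆E′ e∈Y))
        W⊆Z : adjoin e ⊆ Z
        W⊆Z = cl-least fZ (∪-lub Y⊆Z (⁅⁆-⊆ e∈Z))
        C∩W≢0 : r (C ∩ adjoin e) ≢ 0
        C∩W≢0 eq = ℕₚ.1+n≰n (begin
          suc (r G)                              ≡⟨ cong suc rG ⟨
          suc (r Y) + r C                        ≡⟨ ℕₚ.+-comm (suc (r Y)) (r C) ⟩
          r C + suc (r Y)                        ≡⟨ cong (r C +_) rW ⟨
          r C + r (adjoin e)                     ≤⟨ modular mC (adjoin-flat e∈G) ⟩
          r (C ∩ adjoin e) + r (C ∪ adjoin e)    ≡⟨ cong (_+ r (C ∪ adjoin e)) eq ⟩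
          r (C ∪ adjoin e)                       ≤⟨ mono (∪-lub (⊆-ground (flat mC)) cl-⊆) ⟩
          r G                                    ∎)
          where open ℕₚ.≤-Reasoning
        contradiction : Empty.⊥
        contradiction with rank≢0-nonempty C∩W≢0
        ... | x , x∈ = meets x∈C x∉H (disjoint-mono (∩-mono x⊆Z (λ y → y)) Z∩X)
          where
          x∈C : x ∈ C
          x∈C = fst∩ x∈
          x∈W : x ∈ adjoin e
          x∈W = snd∩ {A = C} x∈
          x∉H : x ∉ H
          x∉H x∈H = e∉E′ (exchange fY fE′ Y⊆E′ e∈G x∈W (λ x∈Y → disjoint Y∩C x∈Y x∈C) (H⊆E′ x∈H))
          x⊆Z : adjoin x ⊆ Z
          x⊆Z = cl-least fZ (∪-lub Y⊆Z (⁅⁆-⊆ (W⊆Z x∈W)))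

      to : Skew E′ (X ∩ E′) Y Z → Skew G X Y Z
      to (fZ , Y⊆Z , Z∩X′) = flat-extend fE′ fZ , Y⊆Z
        , disjoint-mono (∩-glb fst∩ (∩-glb snd∩ (λ x → ⊆-ground fZ (fst∩ x)))) Z∩X′

      from : Skew G X Y Z → Skew E′ (X ∩ E′) Y Z
      from s@(fZ , Y⊆Z , Z∩X) = flat-restrict (⊆-ground fE′) (in-E′ s) fZ , Y⊆Z
        , disjoint-mono (∩-mono (λ x → x) fst∩) Z∩X

      X∪E′-spans : r G ≤ r (X ∪ E′)
      X∪E′-spans with ⊈-witness {Y = C} {Z = H} (λ C⊆H → ℕₚ.1+n≰n (ℕₚ.≤-trans (ℕₚ.≤-reflexive (sym rC)) (mono C⊆H)))
      ... | x , x∈C , x∉H with rank≢0-nonempty (meets x∈C x∉H)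
      ...   | e , e∈ = ℕₚ.≤-trans (ℕₚ.≤-reflexive rG≡) (ℕₚ.≤-trans (flat-grows fE′ (⊆-ground (flat mX) e∈X) e∉E′)
                (mono (∪-lub inr (λ y → inl (⁅⁆-⊆ e∈X y)))))
        where
        e∈X : e ∈ X
        e∈X = snd∩ {A = adjoin x} e∈
        e∉E′ : e ∉ E′
        e∉E′ e∈E′ = E′∌ x∈C x∉H (exchange fY fE′ Y⊆E′ (⊆-ground (flat mC) x∈C) (fst∩ e∈)
          (λ e∈Y → disjoint Y∩X e∈Y e∈X) e∈E′)

      -- `E′` is a hyperplane of `G` that does not contain the modular flat `X`. As both `G` and `X`
      -- lose one rank, a complement of `X ∩ E′` in `E′` is one of `X` in `G`.
      rX : r X ≡ suc (r (X ∩ E′))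
      rX = ℕₚ.+-cancelʳ-≡ (r E′) (r X) _ (ℕₚ.≤-antisym
        (begin
          r X + r E′                     ≤⟨ modular mX fE′ ⟩
          r (X ∩ E′) + r (X ∪ E′)        ≤⟨ ℕₚ.+-monoʳ-≤ (r (X ∩ E′)) (mono (∪-lub (⊆-ground (flat mX)) (⊆-ground fE′))) ⟩
          r (X ∩ E′) + r G               ≡⟨ cong (r (X ∩ E′) +_) rG≡ ⟩
          r (X ∩ E′) + suc (r E′)        ≡⟨ ℕₚ.+-suc _ _ ⟩
          suc (r (X ∩ E′)) + r E′        ∎)
        (begin
          suc (r (X ∩ E′)) + r E′        ≡⟨ ℕₚ.+-suc _ _ ⟨
          r (X ∩ E′) + suc (r E′)        ≡⟨ cong (r (X ∩ E′) +_) rG≡ ⟨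
          r (X ∩ E′) + r G               ≤⟨ ℕₚ.+-monoʳ-≤ (r (X ∩ E′)) X∪E′-spans ⟩
          r (X ∩ E′) + r (X ∪ E′)        ≡⟨ ℕₚ.+-comm (r (X ∩ E′)) _ ⟩
          r (X ∪ E′) + r (X ∩ E′)        ≤⟨ r-submod X E′ ⟩
          r X + r E′                     ∎))
        where open ℕₚ.≤-Reasoning

      flag : Flag E′ (X ∩ E′) Y → Flag G X Y
      flag = Transfer.flag-transfer fE′ to from (λ x → x) (λ _ _ st → st)
        (λ {Z} _ eq → done (trans (cong (r Z +_) rX) (trans (ℕₚ.+-suc (r Z) _) (trans (cong suc eq) (sym rG≡)))))
        (fY′ , (λ x → x) , Y∩X′)

  -- In one branch the base grows, in the other the ground set shrinks; both replace `C` by `H`. The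
  -- length index decreases even where the chain is rebuilt by `chain-restrict`.
  chain-flag : ModularChain G k C → IsFlat G Y → r (Y ∩ C) ≡ 0 → r Y + r C ≡ r G →
               IsModular G X → r (Y ∩ X) ≡ 0 → Flag G X Y
  chain-flag {G = G} {Y = Y} {X = X} (base mC rC) fY Y∩C rG mX Y∩X =
    done (trans (cong (r Y +_) (trans rX (sym rC))) rG)
    where
    G⊆Y : G ⊆ Y
    G⊆Y = flat-max fY (⊆-ground fY) (λ x → x)
      (ℕₚ.≤-reflexive (trans (sym rG) (trans (cong (r Y +_) rC) (ℕₚ.+-identityʳ (r Y)))))
    rX : r X ≡ 0
    rX = ℕₚ.n≤0⇒n≡0 (ℕₚ.≤-trans (mono (∩-glb (λ x → G⊆Y (⊆-ground (flat mX) x)) (λ x → x))) (ℕₚ.≤-reflexive Y∩X))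
  chain-flag {G = G} {C = C} {Y = Y} {X = X} (ext {H = H} mC H⊆C rC ch) fY Y∩C rG mX Y∩X
    with Finₚ.any? (λ x → (x ∈? C) ×-dec ¬? (x ∈? H) ×-dec (r (cl M G (Y ∪ ⁅ x ⁆) ∩ X) ℕₚ.≟ 0))
  ... | yes (x , x∈C , x∉H , x∩X) = Contract.flag x∈C x∉H x∩X
    (λ fY′ Y′∩H rG′ → chain-flag ch fY′ Y′∩H rG′ mX x∩X)
    where open ChainStep mC (chain-modular ch) H⊆C rC fY Y∩C rG mX Y∩X
  ... | no ∄ = flag (chain-flag (chain-restrict fE′ H⊆E′ ch) fY′ Y∩H (sym rE′) mX′ Y∩X′)
    where
    open ChainStep mC (chain-modular ch) H⊆C rC fY Y∩C rG mX Y∩X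
    open Restrict (λ x∈C x∉H eq → ∄ (_ , x∈C , x∉H , eq))

  -- Quantified over every ground set, so that the property persists when `X` is regarded inside one
  -- side of a join.
  Round : Subset n → Set
  Round X = ∀ {E A B} → IsFlat E A → IsFlat E B → X ⊆ A ∪ B → X ⊆ A ⊎ X ⊆ B

  -- The induction hypothesis quantifies over an ambient G in which E is modular with complement Y, so that
  -- [ Y , G ] is a copy of the lattice of flats of E and no isomorphism has to be transported.
  Flagged : Subset n → Set
  Flagged E = ∀ {G Y X} → IsModular G E → IsFlat G Y → r (Y ∩ E) ≡ 0 → r Y + r E ≡ r G →
              IsModular E X → Round X → Flag G X Y

  chain-flagged : ModularChain E k E → Flagged E
  chain-flagged ch mE fY Y∩E rG mX _ = chain-flag (chain-trans mE ch) fY Y∩E rG (modular-trans mX mE)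
    (disjoint-mono (∩-mono (λ x → x) (⊆-ground (flat mX))) Y∩E)

  module Join (m₁ : IsModular E E₁) (m₂ : IsModular E E₂) (cover : E ⊆ E₁ ∪ E₂)
    (ih₁ : Flagged E₁) (ih₂ : Flagged E₂) (round : Round (E₁ ∩ E₂))
    (mE : IsModular G E) (fY : IsFlat G Y) (Y∩E : r (Y ∩ E) ≡ 0) (rG : r Y + r E ≡ r G)
    (mX : IsModular E X) (roundX : Round X) (X⊆E₁ : X ⊆ E₁) where

    E₁⊆E : E₁ ⊆ E
    E₁⊆E = ⊆-ground (flat m₁)

    E₂⊆E : E₂ ⊆ E
    E₂⊆E = ⊆-ground (flat m₂)

    m₁′ : IsModular G E₁
    m₁′ = modular-trans m₁ mE

    m₂′ : IsModular G E₂
    m₂′ = modular-trans m₂ mE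

    Y∩E₂ : r (Y ∩ E₂) ≡ 0
    Y∩E₂ = disjoint-mono (∩-mono (λ x → x) E₂⊆E) Y∩E

    E₂∪Y⊆G : E₂ ∪ Y ⊆ G
    E₂∪Y⊆G = ∪-lub (⊆-ground (flat m₂′)) (⊆-ground fY)

    G₂ : Subset n
    G₂ = cl M G (E₂ ∪ Y)

    fG₂ : IsFlat G G₂
    fG₂ = cl-flat E₂∪Y⊆G

    Y⊆G₂ : Y ⊆ G₂
    Y⊆G₂ y = ⊆-cl E₂∪Y⊆G (inr y)

    E₂⊆G₂ : E₂ ⊆ G₂
    E₂⊆G₂ y = ⊆-cl E₂∪Y⊆G (inl y)

    rG₂ : r Y + r E₂ ≡ r G₂
    rG₂ = trans (ℕₚ.+-comm (r Y) (r E₂)) (sym (trans (r-cl E₂∪Y⊆G) (r-modular-⊕ mE fY Y∩E E₂⊆E)))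

    -- As `G₂` meets `E` only in `E₂`, a flat of `G₂` can meet `E₁` only inside `E₁ ∩ E₂`.
    to : Skew G₂ (E₁ ∩ E₂) Y Z → Skew G E₁ Y Z
    to (fZ , Y⊆Z , Z∩X) = flat-extend fG₂ fZ , Y⊆Z , disjoint-mono
      (∩-glb fst∩ (∩-glb snd∩ (λ x → cl-∪-∩ mE fY Y∩E (flat m₂′) E₂⊆E
        (∩-mono (⊆-ground fZ) E₁⊆E x)))) Z∩X

    -- Since `E` is modular with complement `Y`, the flat `Z` is spanned by `E ∩ Z` and `Y`. As `Z`
    -- avoids `E₁`, the part `E ∩ Z` lies in `E₂`.
    in-G₂ : Skew G E₁ Y Z → Z ⊆ G₂
    in-G₂ {Z = Z} (fZ , Y⊆Z , Z∩E₁) x∈ = snd∩ {A = Z} (flat-max (flat-∩ fZ fG₂) fst∩ (⊆-ground fZ) (begin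
      r Z                      ≤⟨ ℕₚ.+-cancelˡ-≤ (r E) _ _ bound ⟩
      r (E ∩ Z) + r Y          ≤⟨ modular-⊕ mE fY Y∩E fst∩ ⟩
      r ((E ∩ Z) ∪ Y)          ≤⟨ mono (∪-lub (∩-glb snd∩ (λ x → E₂⊆G₂ (Z∩E⊆E₂ x))) (∩-glb Y⊆Z Y⊆G₂)) ⟩
      r (Z ∩ G₂)               ∎) x∈)
      where
      open ℕₚ.≤-Reasoning
      Z∩E⊆E₂ : E ∩ Z ⊆ E₂
      Z∩E⊆E₂ x∈ with x∈p∪q⁻ E₁ E₂ (cover (fst∩ x∈))
      ... | inj₁ x∈E₁ = ⊥-elim (disjoint Z∩E₁ (snd∩ {A = E} x∈) x∈E₁)
      ... | inj₂ x∈E₂ = x∈E₂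
      bound : r E + r Z ≤ r E + (r (E ∩ Z) + r Y)
      bound = begin
        r E + r Z                    ≤⟨ modular mE fZ ⟩
        r (E ∩ Z) + r (E ∪ Z)        ≤⟨ ℕₚ.+-monoʳ-≤ (r (E ∩ Z)) (mono (∪-lub (⊆-ground (flat mE)) (⊆-ground fZ))) ⟩
        r (E ∩ Z) + r G              ≡⟨ cong (r (E ∩ Z) +_) rG ⟨
        r (E ∩ Z) + (r Y + r E)      ≡⟨ solve 3 (λ a y e → a :+ (y :+ e) := e :+ (a :+ y)) refl (r (E ∩ Z)) (r Y) (r E) ⟩
        r E + (r (E ∩ Z) + r Y)      ∎

    from : Skew G E₁ Y Z → Skew G₂ (E₁ ∩ E₂) Y Z
    from s@(fZ , Y⊆Z , Z∩E₁) = flat-restrict (⊆-ground fG₂) (in-G₂ s) fZ , Y⊆Z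
      , disjoint-mono (∩-mono (λ x → x) fst∩) Z∩E₁

    rE : r E + r (E₁ ∩ E₂) ≡ r E₁ + r E₂
    rE = ℕₚ.≤-antisym
      (ℕₚ.≤-trans (ℕₚ.+-monoˡ-≤ (r (E₁ ∩ E₂)) (mono cover)) (r-submod E₁ E₂))
      (ℕₚ.≤-trans (modular m₁ (flat m₂)) (ℕₚ.≤-trans
        (ℕₚ.+-monoʳ-≤ (r (E₁ ∩ E₂)) (mono (∪-lub E₁⊆E E₂⊆E)))
        (ℕₚ.≤-reflexive (ℕₚ.+-comm (r (E₁ ∩ E₂)) (r E)))))

    -- The rank identity `rE` turns a complement of `E₁ ∩ E₂` in `G₂` into a complement of `E₁` in
    -- `G`, which is the base that `ih₁` requires.
    continue : Skew G₂ (E₁ ∩ E₂) Y Z → r Z + r (E₁ ∩ E₂) ≡ r G₂ → Flag G X Z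
    continue {Z = Z} s eq with to s
    ... | fZ , _ , Z∩E₁ = ih₁ m₁′ fZ Z∩E₁ (ℕₚ.+-cancelʳ-≡ (r (E₁ ∩ E₂)) _ _ (begin
      r Z + r E₁ + r (E₁ ∩ E₂)       ≡⟨ solve 3 (λ z e x → z :+ e :+ x := z :+ x :+ e) refl (r Z) (r E₁) (r (E₁ ∩ E₂)) ⟩
      r Z + r (E₁ ∩ E₂) + r E₁       ≡⟨ cong (_+ r E₁) (trans eq (sym rG₂)) ⟩
      r Y + r E₂ + r E₁              ≡⟨ solve 3 (λ y e f → y :+ f :+ e := y :+ (e :+ f)) refl (r Y) (r E₁) (r E₂) ⟩
      r Y + (r E₁ + r E₂)            ≡⟨ cong (r Y +_) rE ⟨
      r Y + (r E + r (E₁ ∩ E₂))      ≡⟨ ℕₚ.+-assoc (r Y) (r E) _ ⟨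
      r Y + r E + r (E₁ ∩ E₂)        ≡⟨ cong (_+ r (E₁ ∩ E₂)) rG ⟩
      r G + r (E₁ ∩ E₂)              ∎)) (modular-restrict mX (flat m₁) X⊆E₁) roundX
      where open ≡-Reasoning

    flag : Flag G X Y
    flag = Transfer.flag-transfer fG₂ to from X⊆E₁
      (λ { (fY , _ , Y∩E₁) (fY′ , _ , Y′∩E₁) → step-mono m₁′ fY Y∩E₁ fY′ Y′∩E₁ X⊆E₁ })
      continue
      (flat-restrict (⊆-ground fG₂) Y⊆G₂ fY , (λ x → x)
        , disjoint-mono (∩-mono (λ x → x) (λ x → E₂⊆E (snd∩ {A = E₁} x))) Y∩E)
      (ih₂ (modular-restrict m₂′ fG₂ E₂⊆G₂) (flat-restrict (⊆-ground fG₂) Y⊆G₂ fY) Y∩E₂ rG₂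
        (modular-∩ m₁ (flat m₂)) round)

  join-flagged : IsModular E E₁ → IsModular E E₂ → E ⊆ E₁ ∪ E₂ →
                 Flagged E₁ → Flagged E₂ → Round (E₁ ∩ E₂) → Flagged E
  join-flagged {E₁ = E₁} {E₂ = E₂} m₁ m₂ cover ih₁ ih₂ round mE fY Y∩E rG mX roundX
    with roundX (flat m₁) (flat m₂) (λ x → cover (⊆-ground (flat mX) x))
  ... | inj₁ X⊆E₁ = Join.flag m₁ m₂ cover ih₁ ih₂ round mE fY Y∩E rG mX roundX X⊆E₁
  ... | inj₂ X⊆E₂ = Join.flag m₂ m₁ (subst (_ ⊆_) (∪-comm E₁ E₂) cover) ih₂ ih₁
    (subst Round (∩-comm E₁ E₂) round) mE fY Y∩E rG mX roundX X⊆E₂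

-- From flags to divisibility of characteristic polynomials

module Divisional {n} (M : Matroid n) (loopless : ∀ e → Matroid.r M ⁅ e ⁆ ≡ 1) where

  open Flats M loopless
  open Möbius M loopless
  open Factorisation M loopless
  open Flags M loopless
  open import Data.Nat.Base using (_+_)
  open Matroid M
  open IsFlat
  open IsModular

  private
    variable
      E Y Y′ : Subset n

  supersolvable-chain : Supersolvable M E → ∃ λ k → ModularChain E k E
  supersolvable-chain {E = E} (C , level , C⊆ , _ , C-top) =
    _ , subst (ModularChain E _) C-top (<-weakInduction (λ i → ModularChain E (toℕ i) (C i))
      (base (mod zero) (proj₂ (level zero))) extend (fromℕ (r E)))
    where
    mod : ∀ i → IsModular E (C i)
    mod i = Modular⇒IsModular (proj₁ (level i))
    extend : ∀ i → ModularChain E (toℕ (inject₁ i)) (C (inject₁ i)) → ModularChain E (suc (toℕ i)) (C (suc i))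
    extend i ch = ext (mod (suc i)) (C⊆ i)
      (trans (proj₂ (level (suc i))) (cong suc (sym (trans (proj₂ (level (inject₁ i))) (Finₚ.toℕ-inject₁ i)))))
      (subst (λ k → ModularChain E k (C (inject₁ i))) (Finₚ.toℕ-inject₁ i) ch)

  -- Reading off a coefficient is one choice of test function, and every flat avoids `⊥`.
  χ≡skewSum : ∀ E Y k → χ M E Y k ≡ skewSum E ⊥ Y (λ j → (r E ∸ j ℕₚ.≟ k) ⊙ 1ℤ)
  χ≡skewSum E Y k = trans (sumℤ-allSubsets _) (∑-cong λ Z →
    trans (if-∧ (cl M E Z ≟S Z) _ (μ M E Y Z))
    (trans (⊙-congʳ (cl M E Z ≟S Z) λ _ → trans (if-∧ (Y ⊆? Z) _ (μ M E Y Z))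
      (⊙-congʳ (Y ⊆? Z) λ _ → trans (if-⌊⌋ (r E ∸ r Z ℕₚ.≟ k) (μ M E Y Z)) (value Z)))
    (trans (⊙-congʳ (cl M E Z ≟S Z) λ _ → ⊙-× (Y ⊆? Z) (r (Z ∩ ⊥) ℕₚ.≟ 0) _)
    (trans (⊙-× (cl M E Z ≟S Z) ((Y ⊆? Z) ×-dec (r (Z ∩ ⊥) ℕₚ.≟ 0)) _)
    (⊙-cong ((cl M E Z ≟S Z) ×-dec (Y ⊆? Z) ×-dec (r (Z ∩ ⊥) ℕₚ.≟ 0)) (skew? E ⊥ Y Z)
      (λ { (f , s) → Flat⇒IsFlat f , s }) (λ { (f , s) → IsFlat⇒Flat f , s }) (λ _ → refl))))))
    where
    value : ∀ Z → (r E ∸ r Z ℕₚ.≟ k) ⊙ μ M E Y Z ≡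
      (r (Z ∩ ⊥) ℕₚ.≟ 0) ⊙ (mob E Y Z ℤ.* ((r E ∸ r Z ℕₚ.≟ k) ⊙ 1ℤ))
    value Z = sym (trans (⊙-yes (r (Z ∩ ⊥) ℕₚ.≟ 0) (trans (cong r (∩-zeroʳ Z)) r-⊥) _)
      (trans (sym (⊙-*ˡ (r E ∸ r Z ℕₚ.≟ k) (mob E Y Z) 1ℤ))
             (cong ((r E ∸ r Z ℕₚ.≟ k) ⊙_) (trans (ℤₚ.*-identityʳ _) (mob≡μ E Y Z)))))

  module _ (a : ℤ) where

    -- The polynomial `t - a`, which is the factor `1 - a t` after reversal.
    linear : List.List ℤ
    linear = ℤ.- a List.∷ 1ℤ List.∷ List.[]

    convolve : (ℕ → ℤ) → ℕ → ℤ
    convolve f k = sumℤ (List.map (λ i → f i ℤ.* coeffL linear (k ∸ i)) (List.upTo (suc k)))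

    convolve-suc : ∀ f k → convolve f (suc k) ≡ f 0 ℤ.* coeffL linear (suc k) ℤ.+ convolve (f ∘ suc) k
    convolve-suc f k = cong (λ xs → f 0 ℤ.* coeffL linear (suc k) ℤ.+ sumℤ xs)
      (trans (Listₚ.map-applyUpTo {A = ℕ} suc (λ i → f i ℤ.* coeffL linear (suc k ∸ i)) (suc k))
        (sym (Listₚ.map-applyUpTo {A = ℕ} (λ i → i) (λ i → f (suc i) ℤ.* coeffL linear (k ∸ i)) (suc k))))

    convolve-linear-zero : ∀ f → convolve f 0 ≡ ℤ.- (a ℤ.* f 0)
    convolve-linear-zero f = ring (f 0) a
      where
      ring : ∀ x a → x ℤ.* (ℤ.- a) ℤ.+ 0ℤ ≡ ℤ.- (a ℤ.* x)
      ring = solve-∀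

    convolve-linear-suc : ∀ f k → convolve f (suc k) ≡ f k ℤ.- a ℤ.* f (suc k)
    convolve-linear-suc f zero = trans (convolve-suc f 0)
      (trans (cong (λ s → f 0 ℤ.* 1ℤ ℤ.+ s) (convolve-linear-zero (f ∘ suc))) (ring (f 0) (f 1) a))
      where
      ring : ∀ x y a → x ℤ.* 1ℤ ℤ.+ ℤ.- (a ℤ.* y) ≡ x ℤ.- a ℤ.* y
      ring = solve-∀
    convolve-linear-suc f (suc k) = trans (convolve-suc f (suc k))
      (trans (cong₂ ℤ._+_ (ℤₚ.*-zeroʳ (f 0)) (convolve-linear-suc (f ∘ suc) k)) (ℤₚ.+-identityˡ _))

  step-divides : ∀ {a} → Step E ⊥ Y Y′ a → PolyDivides (χ M E Y′) (χ M E Y)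
  step-divides {E = E} {Y = Y} {Y′ = Y′} {a} st = linear a , coefficients
    where
    -- With `suc (r E)` in place of `r E`, precomposition with `suc` gives the test function for
    -- coefficient `k`, while on ranks up to `r E` the function itself reads coefficient `k - 1`, or
    -- nothing when `k` is zero.
    shifted : ℕ → ℕ → ℤ
    shifted k j = (suc (r E) ∸ j ℕₚ.≟ k) ⊙ 1ℤ
    χ-step : ∀ k → χ M E Y k ≡ skewSum E ⊥ Y′ (shifted k) ℤ.- a ℤ.* χ M E Y′ k
    χ-step k = trans (χ≡skewSum E Y k) (trans (ℤₚ.i-j≡0⇒i≡j _ _ (defect≡0 st (shifted k)))
      (cong (λ z → skewSum E ⊥ Y′ (shifted k) ℤ.- a ℤ.* z) (sym (χ≡skewSum E Y′ k))))
    coefficients : ∀ k → χ M E Y k ≡ convolve a (χ M E Y′) k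
    coefficients zero = trans (χ-step 0) (trans
      (cong (ℤ._- a ℤ.* χ M E Y′ 0) (trans
        (skewSum-cong E ⊥ Y′ {h′ = λ _ → 0ℤ} (λ j j≤ → ⊙-no (suc (r E) ∸ j ℕₚ.≟ 0)
          (λ eq → ℕₚ.1+n≢0 (trans (sym (ℕₚ.+-∸-assoc 1 j≤)) eq)) 1ℤ))
        (∑-zero λ Z → trans (cong (skew? E ⊥ Y′ Z ⊙_) (ℤₚ.*-zeroʳ (mob E Y′ Z))) (⊙-zero (skew? E ⊥ Y′ Z)))))
      (trans (ℤₚ.+-identityˡ _) (sym (convolve-linear-zero a (χ M E Y′)))))
    coefficients (suc k) = trans (χ-step (suc k)) (trans
      (cong (ℤ._- a ℤ.* χ M E Y′ (suc k)) (trans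
        (skewSum-cong E ⊥ Y′ (λ j j≤ → ⊙-cong (suc (r E) ∸ j ℕₚ.≟ suc k) (r E ∸ j ℕₚ.≟ k)
          (λ eq → ℕₚ.suc-injective (trans (sym (ℕₚ.+-∸-assoc 1 j≤)) eq))
          (λ eq → trans (ℕₚ.+-∸-assoc 1 j≤) (cong suc eq)) (λ _ → refl)))
        (sym (χ≡skewSum E Y′ k))))
      (sym (convolve-linear-suc a (χ M E Y′) k)))

  -- The corank `m` fixes the index type in advance; the rank equation rules out the cases where it
  -- disagrees with the flag.
  divisional-flag : Flag E ⊥ Y → IsFlat E Y → ∀ m → r Y + m ≡ r E →
    ∃ λ (X : Fin (suc m) → Subset n) →
      X zero ≡ Y × X (fromℕ m) ≡ E ×
      (∀ i → Flat M E (X i) × r (X i) ≡ r Y + toℕ i) ×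
      (∀ (i : Fin m) → X (inject₁ i) ⊆ X (suc i) × PolyDivides (χ M E (X (suc i))) (χ M E (X (inject₁ i))))
  divisional-flag {Y = Y} (done eq) fY (suc m) rE =
    ⊥-elim (ℕₚ.1+n≢0 (trans (ℕₚ.+-cancelˡ-≡ (r Y) (suc m) (r ⊥) (trans rE (sym eq))) r-⊥))
  divisional-flag {E = E} {Y = Y} (done eq) fY zero rE = (λ _ → Y) , refl
    , ⊆-antisym (⊆-ground fY) (flat-max fY (⊆-ground fY) (λ x → x)
        (ℕₚ.≤-reflexive (trans (sym rE) (ℕₚ.+-identityʳ (r Y)))))
    , (λ { zero → IsFlat⇒Flat fY , sym (ℕₚ.+-identityʳ (r Y)) })
    , λ ()
  divisional-flag {E = E} {Y = Y} (step a fY′ Y⊆Y′ rY′ _ st fl) fY zero rE = ⊥-elim (ℕₚ.1+n≰n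
    (ℕₚ.≤-trans (ℕₚ.≤-reflexive (trans (cong suc (trans (sym rE) (ℕₚ.+-identityʳ (r Y)))) (sym rY′)))
                (mono (⊆-ground fY′))))
  divisional-flag {E = E} {Y = Y} (step a fY′ Y⊆Y′ rY′ _ st fl) fY (suc m) rE
    with divisional-flag fl fY′ m (trans (cong (_+ m) rY′) (trans (sym (ℕₚ.+-suc (r Y) m)) rE))
  ... | X , refl , X-top , levels , steps = X₊ , refl , X-top , levels₊ , steps₊
    where
    X₊ : Fin (suc (suc m)) → Subset n
    X₊ zero = Y
    X₊ (suc i) = X i
    levels₊ : ∀ i → Flat M E (X₊ i) × r (X₊ i) ≡ r Y + toℕ i
    levels₊ zero = IsFlat⇒Flat fY , sym (ℕₚ.+-identityʳ (r Y))
    levels₊ (suc i) = proj₁ (levels i)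
      , trans (proj₂ (levels i)) (trans (cong (_+ toℕ i) rY′) (sym (ℕₚ.+-suc (r Y) (toℕ i))))
    steps₊ : ∀ i → X₊ (inject₁ i) ⊆ X₊ (suc i) × PolyDivides (χ M E (X₊ (suc i))) (χ M E (X₊ (inject₁ i)))
    steps₊ zero = Y⊆Y′ , step-divides st
    steps₊ (suc i) = steps i

  round-⊥ : Round ⊥
  round-⊥ _ _ _ = inj₁ (⊆-min _)

  flagged⇒divisional : Flagged E → HasDivisionalFlag M E
  flagged⇒divisional {E = E} fl
    with divisional-flag (fl modular-ground flat-⊥
           (trans (cong r (∩-zeroˡ E)) r-⊥) (cong (_+ r E) r-⊥) modular-⊥ round-⊥) flat-⊥ (r E) (cong (_+ r E) r-⊥)
  ... | X , X-bot , X-top , levels , steps = X , X-bot , X-top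
    , (λ i → proj₁ (levels i) , trans (proj₂ (levels i)) (cong (_+ toℕ i) r-⊥)) , steps

-- Roundness of projective geometries and the induction over the class

module Representable {n} (M : Matroid n) (loopless : ∀ e → Matroid.r M ⁅ e ⁆ ≡ 1) where

  open Flats M loopless
  open Möbius M loopless
  open Factorisation M loopless
  open Flags M loopless
  open Divisional M loopless
  open Matroid M
  open IsFlat
  open IsModular

  private
    variable
      E X : Subset n

  ∣∪∣≤ : ∀ {m} (X Y : Subset m) → ∣ X ∪ Y ∣ ≤ ∣ X ∣ ℕ.+ ∣ Y ∣
  ∣∪∣≤ [] [] = z≤n
  ∣∪∣≤ (true ∷ X) (true ∷ Y) = s≤s (ℕₚ.≤-trans (∣∪∣≤ X Y) (ℕₚ.+-monoʳ-≤ ∣ X ∣ (ℕₚ.n≤1+n ∣ Y ∣)))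
  ∣∪∣≤ (true ∷ X) (false ∷ Y) = s≤s (∣∪∣≤ X Y)
  ∣∪∣≤ (false ∷ X) (true ∷ Y) = ℕₚ.≤-trans (s≤s (∣∪∣≤ X Y)) (ℕₚ.≤-reflexive (sym (ℕₚ.+-suc ∣ X ∣ ∣ Y ∣)))
  ∣∪∣≤ (false ∷ X) (false ∷ Y) = ∣∪∣≤ X Y

  ∪⁅⁆-independent : ∀ {a} → ∣ X ∣ ≤ r X → suc (r X) ≤ r (X ∪ ⁅ a ⁆) → r (X ∪ ⁅ a ⁆) ≡ ∣ X ∪ ⁅ a ⁆ ∣
  ∪⁅⁆-independent {X = X} {a = a} ind grows = ℕₚ.≤-antisym (r-card _) (begin
    ∣ X ∪ ⁅ a ⁆ ∣          ≤⟨ ∣∪∣≤ X ⁅ a ⁆ ⟩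
    ∣ X ∣ ℕ.+ ∣ ⁅ a ⁆ ∣    ≡⟨ cong (∣ X ∣ ℕ.+_) (∣⁅x⁆∣≡1 a) ⟩
    ∣ X ∣ ℕ.+ 1            ≡⟨ ℕₚ.+-comm ∣ X ∣ 1 ⟩
    suc ∣ X ∣              ≤⟨ s≤s ind ⟩
    suc (r X)              ≤⟨ grows ⟩
    r (X ∪ ⁅ a ⁆)          ∎)
    where open ℕₚ.≤-Reasoning

  module _ {q : ℕ} (K : FiniteField q) where

    open LinAlg K
    open MatroidsOver K

    commutativeRing : CommutativeRing _ _
    commutativeRing = record { isCommutativeRing = FiniteField.isCommutativeRing K }

    open CommutativeRing commutativeRing using
      (Carrier; _+_; _*_; -_; 0#; 1#; ring; +-assoc; +-comm; +-identityˡ; +-identityʳ; -‿inverseʳ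
      ; *-identityˡ; distribʳ; zeroˡ)
    open Algebra.Properties.Ring ring using (-‿distribˡ-*)

    single : ∀ {m} → Fin m → Carrier → Fin m → Carrier
    single zero    c zero    = c
    single zero    c (suc j) = 0#
    single (suc i) c zero    = 0#
    single (suc i) c (suc j) = single i c j

    single-≡ : ∀ {m} (i : Fin m) c → single i c i ≡ c
    single-≡ zero c = refl
    single-≡ (suc i) c = single-≡ i c

    single-≢ : ∀ {m} {i j : Fin m} c → i ≢ j → single i c j ≡ 0#
    single-≢ {i = zero} {zero} c i≢j = ⊥-elim (i≢j refl)
    single-≢ {i = zero} {suc j} c i≢j = refl
    single-≢ {i = suc i} {zero} c i≢j = refl
    single-≢ {i = suc i} {suc j} c i≢j = single-≢ c (i≢j ∘ cong suc)

    sumF-+ : ∀ {m} (c d f : Fin m → Carrier) →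
             sumF (λ i → (c i + d i) * f i) ≡ sumF (λ i → c i * f i) + sumF (λ i → d i * f i)
    sumF-+ {zero} c d f = sym (+-identityˡ 0#)
    sumF-+ {suc m} c d f = begin
      (c zero + d zero) * f zero + sumF (λ i → (c (suc i) + d (suc i)) * f (suc i))
        ≡⟨ cong₂ _+_ (distribʳ (f zero) (c zero) (d zero)) (sumF-+ (c ∘ suc) (d ∘ suc) (f ∘ suc)) ⟩
      (x + y) + (s + t)
        ≡⟨ trans (+-assoc x y _) (cong (x +_) (trans (sym (+-assoc y s t)) (cong (_+ t) (+-comm y s)))) ⟩
      x + ((s + y) + t)
        ≡⟨ trans (cong (x +_) (+-assoc s y t)) (sym (+-assoc x s _)) ⟩
      (x + s) + (y + t) ∎
      where
      open ≡-Reasoning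
      x y s t : Carrier
      x = c zero * f zero
      y = d zero * f zero
      s = sumF (λ i → c (suc i) * f (suc i))
      t = sumF (λ i → d (suc i) * f (suc i))

    sumF-zero : ∀ {m} (f : Fin m → Carrier) → sumF (λ i → 0# * f i) ≡ 0#
    sumF-zero {zero} f = refl
    sumF-zero {suc m} f = trans (cong₂ _+_ (zeroˡ (f zero)) (sumF-zero (f ∘ suc))) (+-identityˡ 0#)

    sumF-single : ∀ {m} (i : Fin m) c (f : Fin m → Carrier) → sumF (λ j → single i c j * f j) ≡ c * f i
    sumF-single zero c f = trans (cong (c * f zero +_) (sumF-zero (f ∘ suc))) (+-identityʳ _)
    sumF-single (suc i) c f = trans (cong₂ _+_ (zeroˡ (f zero)) (sumF-single i c (f ∘ suc))) (+-identityˡ _)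

    -- The relation has coefficients 1, 1 and `- c`. The points `b` and `x` may coincide and their
    -- coefficients merge; the coefficient at `a` stays 1.
    three-term-dependent : ∀ {d} (v : Fin n → Fin d → Carrier) {a b x : Fin n} {S : Subset n} c →
      (∀ j → v a j + v b j ≡ c * v x j) → a ∈ S → b ∈ S → x ∈ S → a ≢ b → a ≢ x → ¬ LinIndep v S
    three-term-dependent v {a} {b} {x} {S} c rel a∈S b∈S x∈S a≢b a≢x ind =
      FiniteField.0≢1 K (trans (sym (ind coef outside vanishing a)) coef-a)
      where
      coef : Fin n → Carrier
      coef i = single a 1# i + (single b 1# i + single x (- c) i)
      sum-zero : ∀ {x y z} → x ≡ 0# → y ≡ 0# → z ≡ 0# → x + (y + z) ≡ 0#
      sum-zero refl refl refl = trans (+-identityˡ _) (+-identityˡ 0#)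
      outside : ∀ i → i ∉ S → coef i ≡ 0#
      outside i i∉S = sum-zero (single-≢ {i = a} 1# (λ { refl → i∉S a∈S }))
        (single-≢ {i = b} 1# (λ { refl → i∉S b∈S })) (single-≢ {i = x} (- c) (λ { refl → i∉S x∈S }))
      coef-a : coef a ≡ 1#
      coef-a = trans (cong₂ _+_ (single-≡ a 1#) (trans
        (cong₂ _+_ (single-≢ {i = b} 1# (a≢b ∘ sym)) (single-≢ {i = x} (- c) (a≢x ∘ sym))) (+-identityˡ 0#))) (+-identityʳ 1#)
      vanishing : ∀ j → sumF (λ i → coef i * v i j) ≡ 0#
      vanishing j = begin
        sumF (λ i → coef i * v i j)
          ≡⟨ trans (sumF-+ (single a 1#) _ vⱼ) (cong (sumF (λ i → single a 1# i * v i j) +_) (sumF-+ (single b 1#) _ vⱼ)) ⟩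
        sumF (λ i → single a 1# i * v i j) + (sumF (λ i → single b 1# i * v i j) + sumF (λ i → single x (- c) i * v i j))
          ≡⟨ cong₂ _+_ (trans (sumF-single a 1# vⱼ) (*-identityˡ _))
               (cong₂ _+_ (trans (sumF-single b 1# vⱼ) (*-identityˡ _)) (sumF-single x (- c) vⱼ)) ⟩
        v a j + (v b j + - c * v x j)
          ≡⟨ sym (+-assoc _ _ _) ⟩
        (v a j + v b j) + - c * v x j
          ≡⟨ cong₂ _+_ (rel j) (sym (-‿distribˡ-* c (v x j))) ⟩
        c * v x j + - (c * v x j)
          ≡⟨ -‿inverseʳ _ ⟩
        0# ∎
        where
        open ≡-Reasoning
        vⱼ : Fin n → Carrier
        vⱼ i = v i j

    -- For a outside A and b outside B, the line ab carries the third point ⟨v a + v b⟩, which lies in A or in B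
    -- and would drag the whole line into that flat.
    isoPG-round : ∀ {m} → IsoPG M X m → (∀ e f → e ∈ X → f ∈ X → e ≢ f → r (⁅ e ⁆ ∪ ⁅ f ⁆) ≡ 2) → Round X
    isoPG-round {X = X} (v , _ , independent , points , _) pairs {A = A} {B = B} fA fB X⊆A∪B
      with X ⊆? A | X ⊆? B
    ... | yes X⊆A | _ = inj₁ X⊆A
    ... | no _ | yes X⊆B = inj₂ X⊆B
    ... | no X⊈A | no X⊈B = ⊥-elim (contradiction (⊈-witness X⊈A) (⊈-witness X⊈B))
      where
      on-line : ∀ {E A a b x} → IsFlat E A → a ∈ E → a ∈ X → b ∈ X → x ∈ X → b ∈ A → x ∈ A → ∀ c →
                (∀ j → v a j + v b j ≡ c * v x j) → a ∈ A
      on-line {E} {A} {a} {b} {x} fA a∈E a∈X b∈X x∈X b∈A x∈A c rel with a ∈? A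
      ... | yes a∈A = a∈A
      ... | no a∉A = ⊥-elim (three-term-dependent v c rel (inr (x∈⁅x⁆ a)) (inl (inl (x∈⁅x⁆ b)))
        (inl (inr (x∈⁅x⁆ x))) (λ { refl → a∉A b∈A }) (λ { refl → a∉A x∈A })
        (proj₁ (independent (P ∪ ⁅ a ⁆) (∪-lub (∪-lub (⁅⁆-⊆ b∈X) (⁅⁆-⊆ x∈X)) (⁅⁆-⊆ a∈X)))
          (∪⁅⁆-independent (P-independent (b Finₚ.≟ x)) (ℕₚ.≰⇒> λ le →
            a∉A (flat-spanned fA (∪-lub (⁅⁆-⊆ b∈A) (⁅⁆-⊆ x∈A)) (⁅⁆-⊆ a∈E) le (x∈⁅x⁆ a))))))
        where
        P : Subset n
        P = ⁅ b ⁆ ∪ ⁅ x ⁆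
        -- The third point may be `b` itself, in which case `P` is a single point.
        P-independent : Dec (b ≡ x) → ∣ P ∣ ≤ r P
        P-independent (yes refl) = ℕₚ.≤-reflexive (trans (cong ∣_∣ (∪-idem ⁅ b ⁆))
          (trans (∣⁅x⁆∣≡1 b) (sym (trans (cong r (∪-idem ⁅ b ⁆)) (loopless b)))))
        P-independent (no b≢x) = ℕₚ.≤-trans (∣∪∣≤ ⁅ b ⁆ ⁅ x ⁆)
          (ℕₚ.≤-reflexive (trans (cong₂ ℕ._+_ (∣⁅x⁆∣≡1 b) (∣⁅x⁆∣≡1 x)) (sym (pairs b x b∈X x∈X b≢x))))
      other : ∀ {A B e} → e ∉ A → e ∈ A ∪ B → e ∈ B
      other {A} {B} e∉A e∈ with x∈p∪q⁻ A B e∈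
      ... | inj₁ e∈A = ⊥-elim (e∉A e∈A)
      ... | inj₂ e∈B = e∈B
      contradiction : (∃ λ a → a ∈ X × a ∉ A) → (∃ λ b → b ∈ X × b ∉ B) → Empty.⊥
      contradiction (a , a∈X , a∉A) (b , b∈X , b∉B) = cases (points (λ j → v a j + v b j) nonzero)
        where
        a∈B : a ∈ B
        a∈B = other a∉A (X⊆A∪B a∈X)
        b∈A : b ∈ A
        b∈A = other b∉B (subst (b ∈_) (∪-comm A B) (X⊆A∪B b∈X))
        on-A : ∀ {x} → x ∈ X → x ∈ A → ∀ c → (∀ j → v a j + v b j ≡ c * v x j) → Empty.⊥
        on-A x∈X x∈A c rel = a∉A (on-line fA (⊆-ground fB a∈B) a∈X b∈X x∈X b∈A x∈A c rel)
        -- A zero sum would be `0#` times `v b`, the degenerate case in which `b` is the third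
        -- point.
        nonzero : NonZeroVec (λ j → v a j + v b j)
        nonzero eq = on-A b∈X b∈A 0# (λ j → trans (eq j) (sym (zeroˡ _)))
        cases : (∃ λ x → x ∈ X × ∃ λ c → ∀ j → v a j + v b j ≡ c * v x j) → Empty.⊥
        cases (x , x∈X , c , rel) with x∈p∪q⁻ A B (X⊆A∪B x∈X)
        ... | inj₁ x∈A = on-A x∈X x∈A c rel
        ... | inj₂ x∈B = b∉B (on-line fB (⊆-ground fA b∈A) b∈X a∈X x∈X a∈B x∈B c
                              (λ j → trans (+-comm _ _) (rel j)))

    inF-flagged : InF M E → Flagged E
    inF-flagged (supersolvable _ _ ss) = chain-flagged (proj₂ (supersolvable-chain ss))
    inF-flagged (modularJoin (_ , pairs) _ E₁ E₂ m₁ _ m₂ _ E≡ in₁ in₂ _ iso) =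
      join-flagged m₁′ m₂′ (subst (_ ∈_) E≡) (inF-flagged in₁) (inF-flagged in₂)
        (isoPG-round iso λ e f e∈ f∈ → pairs e f (E₁⊆E (fst∩ e∈)) (E₁⊆E (fst∩ f∈)))
      where
      m₁′ = Modular⇒IsModular m₁
      m₂′ = Modular⇒IsModular m₂
      E₁⊆E = ⊆-ground (flat m₁′)

theorem4p27 : {q : ℕ} (F : FiniteField q) {ℓ n : ℕ} (A : LinAlg.Arrangement F ℓ n) (M : Matroid n) →
    MatroidsOver.IsMatroidOf F A M → MatroidsOver.InF F M ⊤ → HasDivisionalFlag M ⊤
theorem4p27 F A M _ inF = flagged⇒divisional (inF-flagged F inF)
  where
  simple : ∀ {E} → MatroidsOver.InF F M E → Simple M E
  simple (MatroidsOver.supersolvable s _ _) = s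
  simple (MatroidsOver.modularJoin s _ _ _ _ _ _ _ _ _ _ _ _) = s
  loopless : ∀ e → Matroid.r M ⁅ e ⁆ ≡ 1
  loopless e = proj₁ (simple inF) e ∈⊤
  open Divisional M loopless using (flagged⇒divisional)
  open Representable M loopless using (inF-flagged)
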